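{- Let $\Lambda=(\Lambda_1,\dots,\Lambda_s)$ be a composition of $n$ and $\lambda=\mathrm{sort}(\Lambda)$; let $\Lambda^*=(\Lambda_1,\dots,\Lambda_{s-1})$ and $\lambda^*=\mathrm{sort}(\Lambda^*)$. For every partition $\mu$ of $n$ with $\lambda\trianglelefteq\mu'$, \[ \mathrm{F}_{\mu\Lambda}(q)=\sum_{\nu}\mathrm{G}^*(\mu,\nu,\Lambda_s)\,\mathrm{F}_{\nu\Lambda^*}(q), \] the sum over partitions $\nu$ of $n-\Lambda_s$ with $\lambda^*\trianglelefteq\nu'$ such that $\mu$ is $(\nu,\Lambda_s)$-eligible, where $\mathrm{G}^*(\mu,\nu,\Lambda_s)$ is the number of $(\mu,\nu,\Lambda_s)$-admissible matrices.
   Context: Work over $\mathbb{F}_q$, $q$ a prime power. For a composition $\Lambda$, $\mathfrak{u}_\Lambda(\mathbb{F}_q)$ is the nilradical of the standard parabolic subalgebra of $\mathfrak{gl}_n(\mathbb{F}_q)$ with diagonal blocks of sizes $\Lambda_1,\dots,\Lambda_s$; $J_\mu$ is the nilpotent Jordan matrix of type $\mu$ (upper triangular blocks); $\mathcal{C}_\mu$ its conjugacy class under $\mathrm{GL}$ of the appropriate size; $\mathrm{F}_{\mu\Lambda}(q)=|\mathcal{C}_\mu\cap\mathfrak{u}_\Lambda(\mathbb{F}_q)|$. $\mathrm{sort}$ sorts parts decreasingly, $'$ denotes conjugate, $\trianglelefteq$ dominance. For $1\le m\le n$ and $\nu\vdash n-m$, an $(n-m)\times m$ matrix $Z$ is $(\mu,\nu,m)$-admissible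 if $\begin{pmatrix}J_\nu&Z\\0&0_{m\times m}\end{pmatrix}\in\mathcal{C}_\mu$, and $\mu$ is $(\nu,m)$-eligible if such a $Z$ exists. -}

module Defs where

open import Level using (0ℓ)
open import Data.Bool using (Bool; true; false; if_then_else_; _∧_)
open import Data.Nat using (ℕ; zero; suc; _∸_; _≤_; _<_; _<ᵇ_; _⊔_; _≤?_; _<?_)
import Data.Nat as ℕ
import Data.Nat.Properties as ℕP
open import Data.Fin using (Fin; toℕ; splitAt)
open import Data.Fin.Properties using (all?)
open import Data.Sum using (inj₁; inj₂)
open import Data.Vec using (Vec; []; _∷_; lookup; tabulate)
open import Data.Vec.Properties using (≡-dec)
open import Data.List using (List; []; _∷_; length; filter; map; reverse; take; upTo; cartesianProductWith; [_]; foldr)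
import Data.List as L
open import Data.List.Membership.Propositional using (_∈_; lose)
open import Data.List.Membership.Propositional.Properties using (∈-cartesianProductWith⁺)
open import Data.List.Relation.Unary.Any using (any?; satisfied)
open import Data.List.Relation.Unary.All using (All)
open import Data.List.Relation.Unary.Linked using (Linked)
open import Data.List.Relation.Unary.Unique.Propositional using (Unique)
open import Data.List.Relation.Unary.Any using (here; there)
open import Data.Product using (Σ; ∃; _×_; _,_; proj₁; proj₂)
open import Relation.Nullary using (¬_; Dec; yes; no; does)
open import Relation.Nullary.Decidable using (_×-dec_; _→-dec_)
open import Relation.Binary using (DecidableEquality)
open import Relation.Binary.PropositionalEquality using (_≡_; refl)
open import Algebra.Structures using (IsCommutativeRing)
open import Data.List.Sort.MergeSort ℕP.≤-decTotalOrder using (sort)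

-- Finite fields F_q  (q = length elements; automatically a prime power)

record FiniteField : Set₁ where
  infixl 6 _+_
  infixl 7 _*_
  field
    Carrier  : Set
    _+_ _*_  : Carrier → Carrier → Carrier
    -_       : Carrier → Carrier
    0# 1#    : Carrier
    isCommutativeRing : IsCommutativeRing _≡_ _+_ _*_ -_ 0# 1#
    0≢1      : ¬ (0# ≡ 1#)
    inverse  : ∀ x → ¬ (x ≡ 0#) → ∃ λ y → x * y ≡ 1#
    _≟_      : DecidableEquality Carrier
    elements : List Carrier
    complete : ∀ x → x ∈ elements
    unique   : Unique elements

sumL : List ℕ → ℕ
sumL = foldr ℕ._+_ 0

IsComposition : List ℕ → ℕ → Set
IsComposition Λ n = All (0 <_) Λ × sumL Λ ≡ n

IsPartition : List ℕ → ℕ → Set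
IsPartition μ n = All (0 <_) μ × Linked (λ a b → b ≤ a) μ × sumL μ ≡ n

sortDesc : List ℕ → List ℕ
sortDesc Λ = reverse (sort Λ)

maxL : List ℕ → ℕ
maxL = foldr _⊔_ 0

conj : List ℕ → List ℕ
conj μ = map (λ i → length (filter (λ p → suc i ≤? p) μ)) (upTo (maxL μ))

_⊴_ : List ℕ → List ℕ → Set
λ₀ ⊴ μ = ∀ k → sumL (take k λ₀) ≤ sumL (take k μ)

allVecs : {A : Set} → List A → (k : ℕ) → List (Vec A k)
allVecs xs zero    = [ [] ]
allVecs xs (suc k) = cartesianProductWith _∷_ xs (allVecs xs k)

allVecs-complete : {A : Set} (xs : List A) → (∀ x → x ∈ xs) →
                   ∀ {k} (v : Vec A k) → v ∈ allVecs xs k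
allVecs-complete xs c []       = here refl
allVecs-complete xs c (x ∷ v)  =
  ∈-cartesianProductWith⁺ _∷_ (c x) (allVecs-complete xs c v)

decΣ : {A : Set} (xs : List A) → (∀ x → x ∈ xs) →
       {P : A → Set} → (∀ x → Dec (P x)) → Dec (Σ A P)
decΣ xs c P? with any? P? xs
... | yes p = yes (satisfied p)
... | no ¬p = no λ { (x , px) → ¬p (lose (c x) px) }

count : {A : Set} {P : A → Set} → (∀ x → Dec (P x)) → List A → ℕ
count P? xs = length (filter P? xs)

-- position i has a 1 in entry (i , i+1) of J_μ (i and i+1 in the same block)
superOne : List ℕ → ℕ → Bool
superOne []      i = false
superOne (a ∷ μ) i = if suc i <ᵇ a then true else (if i <ᵇ a then false else superOne μ (i ∸ a))

blockOf : List ℕ → ℕ → ℕ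
blockOf []      i = 0
blockOf (a ∷ Λ) i = if i <ᵇ a then 0 else suc (blockOf Λ (i ∸ a))

module _ (𝔽 : FiniteField) where
  open FiniteField 𝔽

  Mat : ℕ → ℕ → Set
  Mat a b = Vec (Vec Carrier b) a

  entry : ∀ {a b} → Mat a b → Fin a → Fin b → Carrier
  entry X i j = lookup (lookup X i) j

  allMats : (a b : ℕ) → List (Mat a b)
  allMats a b = allVecs (allVecs elements b) a

  allMats-complete : ∀ {a b} (X : Mat a b) → X ∈ allMats a b
  allMats-complete X = allVecs-complete _ (allVecs-complete elements complete) X

  _≟M_ : ∀ {a b} → DecidableEquality (Mat a b)
  _≟M_ = ≡-dec (≡-dec _≟_)

  sumF : ∀ {k} → (Fin k → Carrier) → Carrier
  sumF {zero}  f = 0#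
  sumF {suc k} f = f Fin.zero + sumF (λ i → f (Fin.suc i))

  _·_ : ∀ {a b c} → Mat a b → Mat b c → Mat a c
  X · Y = tabulate λ i → tabulate λ j → sumF (λ k → entry X i k * entry Y k j)

  idM : ∀ {k} → Mat k k
  idM = tabulate λ i → tabulate λ j → if does (i Data.Fin.≟ j) then 1# else 0#

  Conj : ∀ {k} → Mat k k → Mat k k → Set
  Conj {k} X Y = Σ (Mat k k) λ g → Σ (Mat k k) λ h →
                   ((g · h) ≡ idM) × ((g · X) ≡ (Y · g))

  Conj? : ∀ {k} (X Y : Mat k k) → Dec (Conj X Y)
  Conj? {k} X Y = decΣ (allMats k k) allMats-complete λ g →
                  decΣ (allMats k k) allMats-complete λ h →
                  ((g · h) ≟M idM) ×-dec ((g · X) ≟M (Y · g))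

  -- the nilpotent Jordan matrix of type μ (upper triangular blocks),
  -- padded with zeros to size k (only used with k = |μ|)
  jordan : List ℕ → (k : ℕ) → Mat k k
  jordan μ k = tabulate λ i → tabulate λ j →
    if does (toℕ j ℕ.≟ suc (toℕ i)) ∧ superOne μ (toℕ i) then 1# else 0#

  J : (μ : List ℕ) → Mat (sumL μ) (sumL μ)
  J μ = jordan μ (sumL μ)

  InClass : List ℕ → ∀ {k} → Mat k k → Set
  InClass μ {k} X = (sumL μ ≡ k) × Conj X (jordan μ k)

  InClass? : ∀ μ {k} (X : Mat k k) → Dec (InClass μ X)
  InClass? μ {k} X = (sumL μ ℕ.≟ k) ×-dec Conj? X (jordan μ k)

  InNilradical : (Λ : List ℕ) → Mat (sumL Λ) (sumL Λ) → Set
  InNilradical Λ X = ∀ i j → blockOf Λ (toℕ j) ≤ blockOf Λ (toℕ i) → entry X i j ≡ 0#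

  InNilradical? : ∀ Λ X → Dec (InNilradical Λ X)
  InNilradical? Λ X = all? λ i → all? λ j →
    (blockOf Λ (toℕ j) ≤? blockOf Λ (toℕ i)) →-dec (entry X i j ≟ 0#)

  F : List ℕ → List ℕ → ℕ
  F μ Λ = count (λ X → InNilradical? Λ X ×-dec InClass? μ X) (allMats (sumL Λ) (sumL Λ))

  blockMat : (ν : List ℕ) (m : ℕ) → Mat (sumL ν) m → Mat (sumL ν ℕ.+ m) (sumL ν ℕ.+ m)
  blockMat ν m Z = tabulate λ i → tabulate λ j → go (splitAt (sumL ν) i) (splitAt (sumL ν) j)
    where
    go : _ → _ → Carrier
    go (inj₁ i) (inj₁ j) = entry (J ν) i j
    go (inj₁ i) (inj₂ j) = entry Z i j
    go (inj₂ i) _        = 0#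

  Admissible : List ℕ → (ν : List ℕ) (m : ℕ) → Mat (sumL ν) m → Set
  Admissible μ ν m Z = InClass μ (blockMat ν m Z)

  Eligible : List ℕ → List ℕ → ℕ → Set
  Eligible μ ν m = Σ (Mat (sumL ν) m) (Admissible μ ν m)

  Gstar : List ℕ → List ℕ → ℕ → ℕ
  Gstar μ ν m = count (λ Z → InClass? μ (blockMat ν m Z)) (allMats (sumL ν) m)

module Submission where

-- A matrix in the nilradical of (Λ*, m) is (A Z; 0 0) with A in the nilradical of Λ* and Z arbitrary. As A is
-- nilpotent, g A g⁻¹ = J_ν for a unique partition ν, and conjugating by diag(g, 1) turns (A Z; 0 0) into
-- (J_ν gZ; 0 0); so exactly G*(μ, ν, m) of the matrices Z are suitable, and summing over A gives the formula.
-- That sort(Λ*) ⊴ ν′ is automatic: ν′₁ + … + ν′ₖ = dim ker Aᵏ, and each block of Λ* that is peeled off the flag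
-- may be used to enlarge the kernel by its size at the cost of one more power of A.

open import Defs
open import Level using (0ℓ)
open import Algebra.Bundles using (CommutativeRing)
open import Data.Bool using (true; false; if_then_else_; _∧_; T)
open import Data.Empty using (⊥-elim)
open import Data.Fin as Fin using (Fin; toℕ; splitAt; _↑ˡ_; _↑ʳ_)
import Data.Fin.Properties as FinP
open import Data.List as List using (List; []; _∷_; length)
import Data.List.Properties as ListP
open import Data.List.Membership.Propositional using (_∈_)
import Data.List.Membership.Propositional.Properties as ∈P
open import Data.List.Relation.Binary.Permutation.Propositional as ↭ using (_↭_; ↭-sym)
import Data.List.Relation.Binary.Permutation.Propositional.Properties as ↭P
import Data.List.Relation.Binary.Sublist.Heterogeneous.Properties as SubP
open import Data.List.Relation.Binary.Sublist.Propositional as Sub using (_⊆_; []; _∷_)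
open import Data.List.Relation.Unary.All as All using (All; []; _∷_)
import Data.List.Relation.Unary.All.Properties as AllP
open import Data.List.Relation.Unary.Any using (here; there)
open import Data.List.Relation.Unary.Linked as Linked using (Linked; []; _∷_; [-])
import Data.List.Relation.Unary.Linked.Properties as LinkedP
open import Data.List.Relation.Unary.Unique.Propositional using (Unique; []; _∷_)
import Data.List.Relation.Unary.Unique.Propositional.Properties as UniqueP
open import Data.List.Reverse using (Reverse; reverseView; []; _∶_∶ʳ_)
open import Data.List.Sort.Base using (SortingAlgorithm)
open import Data.List.Sort.MergeSort using (mergeSort)
open import Data.Nat as ℕ using (ℕ; zero; suc; _≤_; _<_; z≤n; s≤s)
open import Data.Nat.ListAction.Properties using (sum-++; sum-↭)
import Data.Nat.Properties as ℕP
open import Algebra.Properties.CommutativeSemigroup ℕP.+-commutativeSemigroup using () renaming (x∙yz≈y∙xz to ℕ-swap; interchange to ℕ-interchange)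
open import Data.Product using (Σ; ∃; _×_; _,_; proj₁; proj₂)
open import Data.Sum using (_⊎_; inj₁; inj₂; [_,_]′)
open import Data.Unit using (⊤)
open import Data.Vec as Vec using (Vec; []; _∷_; _∷ʳ_; head; lookup; replicate; tabulate; tail; zipWith)
import Data.Vec.Properties as VecP
open import Function using (_∘_; id)
open import Function.Bundles using (_⇔_; Equivalence)
open import Relation.Binary using (DecTotalOrder)
import Relation.Binary.Construct.On as On
open import Relation.Binary.Properties.DecTotalOrder using (≥-decTotalOrder)
open import Relation.Binary.PropositionalEquality hiding (J; [_])
open import Relation.Nullary using (¬_; Dec; yes; no; does)
open import Relation.Nullary.Decidable using (_×-dec_; _→-dec_)

-- No notion of rank or basis is set up. A lower bound for a dimension is an injective linear map
-- out of some `V d`, and every inequality between dimensions rests on one fact: a linear map into a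
-- space with fewer coordinates has a nonzero kernel vector.
--
-- The existence of the Jordan form is the long part. Instead of splitting off one block after
-- another, the argument takes an extravagant family, every vector of the finite space as the top of
-- a chain, and lets linear relations shorten the chains until their total length is `n`. Uniqueness
-- comes from the dimensions of the kernels of powers, the same numbers that decide dominance.
--
-- The bijections between X and (A , Z), and between Z and g Z, enter the count as pairs of
-- injections.

-- Partitions and their column sums

-- The number of boxes in the first `k` columns of the diagram of `ν`, counted row by row. It is the
-- sum of the first `k` parts of the conjugate and also the dimension of the kernel of the `k`-th
-- power of J_ν, so it links `conj` to linear algebra.
capSum : ℕ → List ℕ → ℕ
capSum k ν = sumL (List.map (k ℕ.⊓_) ν)

capSum-suc : ∀ t ν → capSum (suc t) ν ≡ capSum t ν ℕ.+ length (List.filter (suc t ℕP.≤?_) ν)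
capSum-suc t []      = refl
capSum-suc t (b ∷ ν) with suc t ℕP.≤? b
... | yes t<b = begin
  suc t ℕ.⊓ b ℕ.+ capSum (suc t) ν      ≡⟨ cong₂ ℕ._+_ (ℕP.m≤n⇒m⊓n≡m t<b) (capSum-suc t ν) ⟩
  suc t ℕ.+ (capSum t ν ℕ.+ c)          ≡⟨ cong suc (ℕP.+-assoc t (capSum t ν) c) ⟨
  suc (t ℕ.+ capSum t ν ℕ.+ c)          ≡⟨ ℕP.+-suc _ c ⟨
  t ℕ.+ capSum t ν ℕ.+ suc c            ≡⟨ cong (λ p → p ℕ.+ capSum t ν ℕ.+ suc c) (ℕP.m≤n⇒m⊓n≡m (ℕP.<⇒≤ t<b)) ⟨
  t ℕ.⊓ b ℕ.+ capSum t ν ℕ.+ suc c      ≡⟨ cong (λ xs → t ℕ.⊓ b ℕ.+ capSum t ν ℕ.+ length xs) (ListP.filter-accept (suc t ℕP.≤?_) t<b) ⟨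
  t ℕ.⊓ b ℕ.+ capSum t ν ℕ.+ length (List.filter (suc t ℕP.≤?_) (b ∷ ν)) ∎
  where
  open ≡-Reasoning
  c = length (List.filter (suc t ℕP.≤?_) ν)
... | no t≮b = begin
  suc t ℕ.⊓ b ℕ.+ capSum (suc t) ν      ≡⟨ cong₂ ℕ._+_ (ℕP.m≥n⇒m⊓n≡n (ℕP.<⇒≤ (ℕP.≰⇒> t≮b))) (capSum-suc t ν) ⟩
  b ℕ.+ (capSum t ν ℕ.+ c)              ≡⟨ ℕP.+-assoc b (capSum t ν) c ⟨
  b ℕ.+ capSum t ν ℕ.+ c                ≡⟨ cong (λ p → p ℕ.+ capSum t ν ℕ.+ c) (ℕP.m≥n⇒m⊓n≡n (ℕP.≤-pred (ℕP.≰⇒> t≮b))) ⟨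
  t ℕ.⊓ b ℕ.+ capSum t ν ℕ.+ c          ≡⟨ cong (λ xs → t ℕ.⊓ b ℕ.+ capSum t ν ℕ.+ length xs) (ListP.filter-reject (suc t ℕP.≤?_) t≮b) ⟨
  t ℕ.⊓ b ℕ.+ capSum t ν ℕ.+ length (List.filter (suc t ℕP.≤?_) (b ∷ ν)) ∎
  where
  open ≡-Reasoning
  c = length (List.filter (suc t ℕP.≤?_) ν)

capSum-zero : ∀ ν → capSum 0 ν ≡ 0
capSum-zero []      = refl
capSum-zero (b ∷ ν) = capSum-zero ν

capSum-applyUpTo : ∀ t ν → sumL (List.applyUpTo (λ i → length (List.filter (suc i ℕP.≤?_) ν)) t) ≡ capSum t ν
capSum-applyUpTo zero    ν = sym (capSum-zero ν)
capSum-applyUpTo (suc t) ν = begin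
  sumL (List.applyUpTo g (suc t))              ≡⟨ cong sumL (ListP.applyUpTo-∷ʳ g t) ⟨
  sumL (List.applyUpTo g t List.++ g t ∷ [])   ≡⟨ sum-++ (List.applyUpTo g t) (g t ∷ []) ⟩
  sumL (List.applyUpTo g t) ℕ.+ (g t ℕ.+ 0)    ≡⟨ cong₂ ℕ._+_ (capSum-applyUpTo t ν) (ℕP.+-identityʳ (g t)) ⟩
  capSum t ν ℕ.+ g t                           ≡⟨ capSum-suc t ν ⟨
  capSum (suc t) ν                             ∎
  where
  open ≡-Reasoning
  g : ℕ → ℕ
  g i = length (List.filter (suc i ℕP.≤?_) ν)

take-applyUpTo : {A : Set} (g : ℕ → A) → ∀ k n → List.take k (List.applyUpTo g n) ≡ List.applyUpTo g (k ℕ.⊓ n)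
take-applyUpTo g zero    n       = refl
take-applyUpTo g (suc k) zero    = refl
take-applyUpTo g (suc k) (suc n) = cong (g 0 ∷_) (take-applyUpTo (g ∘ suc) k n)

-- `conj` ends at the largest part, so `take k` of it may stop before `k`; a cap above every part
-- has no effect, which closes that gap.
capSum-⊓ : ∀ k {M} ν → All (_≤ M) ν → capSum (k ℕ.⊓ M) ν ≡ capSum k ν
capSum-⊓ k     []      []          = refl
capSum-⊓ k {M} (b ∷ ν) (b≤M ∷ ν≤M) =
  cong₂ ℕ._+_ (trans (ℕP.⊓-assoc k M b) (cong (k ℕ.⊓_) (ℕP.m≥n⇒m⊓n≡n b≤M))) (capSum-⊓ k ν ν≤M)

all≤maxL : ∀ ν → All (_≤ maxL ν) ν
all≤maxL []      = []
all≤maxL (b ∷ ν) = ℕP.m≤m⊔n b _ ∷ All.map (λ p → ℕP.≤-trans p (ℕP.m≤n⊔m b _)) (all≤maxL ν)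

take-conj : ∀ k ν → sumL (List.take k (conj ν)) ≡ capSum k ν
take-conj k ν = begin
  sumL (List.take k (conj ν))                       ≡⟨ cong (sumL ∘ List.take k) (ListP.map-upTo g (maxL ν)) ⟩
  sumL (List.take k (List.applyUpTo g (maxL ν)))    ≡⟨ cong sumL (take-applyUpTo g k (maxL ν)) ⟩
  sumL (List.applyUpTo g (k ℕ.⊓ maxL ν))            ≡⟨ capSum-applyUpTo (k ℕ.⊓ maxL ν) ν ⟩
  capSum (k ℕ.⊓ maxL ν) ν                           ≡⟨ capSum-⊓ k ν (all≤maxL ν) ⟩
  capSum k ν                                        ∎
  where
  open ≡-Reasoning
  g : ℕ → ℕ
  g i = length (List.filter (suc i ℕP.≤?_) ν)

capSum-monoˡ : ∀ {j k} ν → j ≤ k → capSum j ν ≤ capSum k ν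
capSum-monoˡ []      j≤k = z≤n
capSum-monoˡ (b ∷ ν) j≤k = ℕP.+-mono-≤ (ℕP.⊓-monoˡ-≤ b j≤k) (capSum-monoˡ ν j≤k)

capSum-saturated : ∀ {k} ν → All (_≤ k) ν → capSum k ν ≡ sumL ν
capSum-saturated []      []          = refl
capSum-saturated (b ∷ ν) (b≤k ∷ ν≤k) = cong₂ ℕ._+_ (ℕP.m≥n⇒m⊓n≡n b≤k) (capSum-saturated ν ν≤k)

Descending : List ℕ → Set
Descending = Linked (λ x y → y ≤ x)

all≤head : ∀ {x ν} → Descending (x ∷ ν) → All (_≤ x) (x ∷ ν)
all≤head [-]       = ℕP.≤-refl ∷ []
all≤head (y≤x ∷ l) = ℕP.≤-refl ∷ All.map (λ p → ℕP.≤-trans p y≤x) (all≤head l)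

-- If `y < x`, the sum for `y ∷ ν′` is already complete at `y` and stays constant up to `x`, whereas
-- the sum for `x ∷ ν` still grows there because its first row does.
capSum-head-≤ : ∀ {x y ν ν′} → Descending (y ∷ ν′) → (∀ k → capSum k (x ∷ ν) ≡ capSum k (y ∷ ν′)) → x ≤ y
capSum-head-≤ {x} {y} {ν} {ν′} l e with x ℕP.≤? y
... | yes x≤y = x≤y
... | no  x≰y = ⊥-elim (ℕP.<-irrefl equal strict)
  where
  y<x = ℕP.≰⇒> x≰y
  strict : capSum y (x ∷ ν) < capSum x (x ∷ ν)
  strict = ℕP.+-mono-<-≤ (subst₂ _<_ (sym (ℕP.m≤n⇒m⊓n≡m (ℕP.<⇒≤ y<x))) (sym (ℕP.⊓-idem x)) y<x)
                         (capSum-monoˡ ν (ℕP.<⇒≤ y<x))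
  equal : capSum y (x ∷ ν) ≡ capSum x (x ∷ ν)
  equal = trans (e y) (trans (capSum-saturated (y ∷ ν′) (all≤head l))
          (trans (sym (capSum-saturated (y ∷ ν′) (All.map (λ p → ℕP.≤-trans p (ℕP.<⇒≤ y<x)) (all≤head l)))) (sym (e x))))

-- The largest parts agree by the bound applied both ways; the common term `k ⊓ x` then cancels for
-- every `k`, and the tails satisfy the same hypothesis. This makes the type of a nilpotent matrix
-- unique.
capSum-injective : ∀ ν ν′ → All (0 <_) ν → All (0 <_) ν′ → Descending ν → Descending ν′ →
                   (∀ k → capSum k ν ≡ capSum k ν′) → ν ≡ ν′
capSum-injective []      []       _       _       _ _  e = refl
capSum-injective []      (y ∷ ν′) _       (q ∷ _) _ _  e =
  ⊥-elim (ℕP.<⇒≢ q (sym (trans (sym (ℕP.⊓-idem y)) (ℕP.m+n≡0⇒m≡0 (y ℕ.⊓ y) (sym (e y))))))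
capSum-injective (x ∷ ν) []       (p ∷ _) _       _ _  e =
  ⊥-elim (ℕP.<⇒≢ p (sym (trans (sym (ℕP.⊓-idem x)) (ℕP.m+n≡0⇒m≡0 (x ℕ.⊓ x) (e x)))))
capSum-injective (x ∷ ν) (y ∷ ν′) (p ∷ ps) (q ∷ qs) l l′ e
  with refl ← ℕP.≤-antisym (capSum-head-≤ {ν = ν} l′ e) (capSum-head-≤ {ν = ν′} l (sym ∘ e)) =
  cong (x ∷_) (capSum-injective ν ν′ ps qs (Linked.tail l) (Linked.tail l′)
    (λ k → ℕP.+-cancelˡ-≡ (k ℕ.⊓ x) _ _ (e k)))

-- Selections of blocks and block indices

sublist-↭ : {A : Set} {xs ys zs : List A} → ys ⊆ xs → xs ↭ zs → ∃ λ ws → ws ⊆ zs × ys ↭ ws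
sublist-↭ s ↭.refl = _ , s , ↭.refl
sublist-↭ (y Sub.∷ʳ s)   (↭.prep x p) with ws , t , q ← sublist-↭ s p = ws , x Sub.∷ʳ t , q
sublist-↭ (refl ∷ s) (↭.prep x p) with ws , t , q ← sublist-↭ s p = x ∷ ws , refl ∷ t , ↭.prep x q
sublist-↭ (_ Sub.∷ʳ (_ Sub.∷ʳ s))     (↭.swap x y p) with ws , t , q ← sublist-↭ s p = ws , y Sub.∷ʳ (x Sub.∷ʳ t) , q
sublist-↭ (_ Sub.∷ʳ (refl ∷ s))   (↭.swap x y p) with ws , t , q ← sublist-↭ s p = y ∷ ws , refl ∷ (x Sub.∷ʳ t) , ↭.prep y q
sublist-↭ (refl ∷ (_ Sub.∷ʳ s))   (↭.swap x y p) with ws , t , q ← sublist-↭ s p = x ∷ ws , y Sub.∷ʳ (refl ∷ t) , ↭.prep x q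
sublist-↭ (refl ∷ (refl ∷ s)) (↭.swap x y p) with ws , t , q ← sublist-↭ s p = y ∷ x ∷ ws , refl ∷ (refl ∷ t) , ↭.swap x y q
sublist-↭ s (↭.trans p p′) with ws , t , q ← sublist-↭ s p with us , r , q′ ← sublist-↭ t p′ = us , r , ↭.trans q q′

sortDesc-↭ : ∀ Λ → sortDesc Λ ↭ Λ
sortDesc-↭ Λ = ↭.trans (↭P.↭-reverse (sort Λ)) (sort-↭ Λ)
  where open SortingAlgorithm (mergeSort ℕP.≤-decTotalOrder) using (sort; sort-↭)

-- Blocks are peeled off in the order of the composition, not in sorted order, so the `k` largest
-- parts are needed, up to rearrangement, as a sublist of `Λ` itself. It is shorter than `k` when
-- `Λ` has fewer than `k` parts.
topParts : ∀ k Λ → ∃ λ S → S ⊆ Λ × length S ≤ k × sumL S ≡ sumL (List.take k (sortDesc Λ))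
topParts k Λ with S , S⊆Λ , p ← sublist-↭ (SubP.take-Sublist k Sub.⊆-refl) (sortDesc-↭ Λ) =
  S , S⊆Λ , subst (_≤ k) (trans (sym (ListP.length-take k (sortDesc Λ))) (↭P.↭-length p)) (ℕP.m⊓n≤m k _) , sym (sum-↭ p)

sublist-∷ʳ : {A : Set} {x : A} {ys : List A} → ∀ xs → ys ⊆ xs List.∷ʳ x →
             ys ⊆ xs ⊎ ∃ λ zs → ys ≡ zs List.∷ʳ x × zs ⊆ xs
sublist-∷ʳ []       (_ Sub.∷ʳ [])   = inj₁ []
sublist-∷ʳ []       (refl ∷ []) = inj₂ ([] , refl , [])
sublist-∷ʳ (y ∷ xs) (_ Sub.∷ʳ s) with sublist-∷ʳ xs s
... | inj₁ t             = inj₁ (y Sub.∷ʳ t)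
... | inj₂ (zs , e , t)  = inj₂ (zs , e , y Sub.∷ʳ t)
sublist-∷ʳ (y ∷ xs) (refl ∷ s) with sublist-∷ʳ xs s
... | inj₁ t               = inj₁ (refl ∷ t)
... | inj₂ (zs , refl , t) = inj₂ (y ∷ zs , refl , refl ∷ t)

∸-< : ∀ {i a s} → a ≤ i → i < a ℕ.+ s → i ℕ.∸ a < s
∸-< {i} {a} {s} a≤i lt = ℕP.+-cancelˡ-< a _ s (subst (_< a ℕ.+ s) (sym (ℕP.m+[n∸m]≡n a≤i)) lt)

blockOf-++ˡ : ∀ Λ m {i} → i < sumL Λ → blockOf (Λ List.∷ʳ m) i ≡ blockOf Λ i × blockOf Λ i < length Λ
blockOf-++ˡ (a ∷ Λ) m {i} i<s with i ℕ.<ᵇ a in p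
... | true  = refl , s≤s z≤n
... | false with e , lt ← blockOf-++ˡ Λ m {i ℕ.∸ a} (∸-< (ℕP.≮⇒≥ λ lt → subst T p (ℕP.<⇒<ᵇ lt)) i<s) = cong suc e , s≤s lt

blockOf-++ʳ : ∀ Λ {m} i → i < m → blockOf (Λ List.∷ʳ m) (sumL Λ ℕ.+ i) ≡ length Λ
blockOf-++ʳ []      {m} i i<m with i ℕ.<ᵇ m in p
... | true  = refl
... | false = ⊥-elim (subst T p (ℕP.<⇒<ᵇ i<m))
blockOf-++ʳ (a ∷ Λ) {m} i i<m with (a ℕ.+ sumL Λ ℕ.+ i) ℕ.<ᵇ a in p
... | true  = ⊥-elim (ℕP.<⇒≱ (ℕP.<ᵇ⇒< _ a (subst T (sym p) _)) (subst (a ≤_) (sym (ℕP.+-assoc a (sumL Λ) i)) (ℕP.m≤m+n a _)))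
... | false = cong suc (trans (cong (blockOf (Λ List.∷ʳ m)) (trans (cong (ℕ._∸ a) (ℕP.+-assoc a (sumL Λ) i)) (ℕP.m+n∸m≡n a _)))
                              (blockOf-++ʳ Λ i i<m))

sum-∷ʳ : ∀ Λ m → sumL (Λ List.∷ʳ m) ≡ sumL Λ ℕ.+ m
sum-∷ʳ Λ m = trans (sum-++ Λ (m ∷ [])) (cong (sumL Λ ℕ.+_) (ℕP.+-identityʳ m))

-- Counting in finite lists

-- Removal of one occurrence, marked by its position, so that it also makes sense in lists of
-- chains, where the same chain may occur twice.
data Pick {A : Set} (x : A) : List A → List A → Set where
  here  : ∀ {xs} → Pick x (x ∷ xs) xs
  there : ∀ {y xs ys} → Pick x xs ys → Pick x (y ∷ xs) (y ∷ ys)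

module _ {A : Set} where

  pick-∈ : ∀ {x : A} {xs ys} → Pick x xs ys → x ∈ xs
  pick-∈ here      = here refl
  pick-∈ (there p) = there (pick-∈ p)

  pick-⊆ : ∀ {x y : A} {xs ys} → Pick x xs ys → y ∈ ys → y ∈ xs
  pick-⊆ here      q         = there q
  pick-⊆ (there p) (here e)  = here e
  pick-⊆ (there p) (there q) = there (pick-⊆ p q)

  pick-cases : ∀ {x y : A} {xs ys} → Pick x xs ys → y ∈ xs → y ≡ x ⊎ y ∈ ys
  pick-cases here      (here e)  = inj₁ e
  pick-cases here      (there q) = inj₂ q
  pick-cases (there p) (here e)  = inj₂ (here e)
  pick-cases (there p) (there q) with pick-cases p q
  ... | inj₁ e = inj₁ e
  ... | inj₂ r = inj₂ (there r)

  ∈⇒pick : ∀ {x : A} {xs} → x ∈ xs → ∃ λ ys → Pick x xs ys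
  ∈⇒pick (here refl) = _ , here
  ∈⇒pick (there p) with ys , q ← ∈⇒pick p = _ , there q

  pick-length : ∀ {x : A} {xs ys} → Pick x xs ys → length xs ≡ suc (length ys)
  pick-length here      = refl
  pick-length (there p) = cong suc (pick-length p)

-- Pigeonhole: striking `x` from `ys` keeps the rest of `xs` inside, because `x` does not recur
-- there.
unique-⊆⇒length≤ : {A : Set} (xs ys : List A) → Unique xs → (∀ {x} → x ∈ xs → x ∈ ys) → length xs ≤ length ys
unique-⊆⇒length≤ []       ys _         h = z≤n
unique-⊆⇒length≤ (x ∷ xs) ys (x∉ ∷ xs!) h with ys′ , p ← ∈⇒pick (h (here refl)) =
  subst (suc (length xs) ≤_) (sym (pick-length p)) (s≤s (unique-⊆⇒length≤ xs ys′ xs! λ q → other q (pick-cases p (h (there q)))))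
  where
  other : ∀ {y} → y ∈ xs → y ≡ x ⊎ y ∈ ys′ → y ∈ ys′
  other q (inj₁ refl) = ⊥-elim (All.lookup x∉ q refl)
  other q (inj₂ r)    = r

map-unique : {A B : Set} {P : A → Set} {f : A → B} → (∀ {x y} → P x → P y → f x ≡ f y → x ≡ y) →
             ∀ xs → All P xs → Unique xs → Unique (List.map f xs)
map-unique inj []       _         _          = []
map-unique inj (x ∷ xs) (px ∷ pxs) (x∉ ∷ xs!) =
  AllP.map⁺ (All.zipWith (λ { (py , x≢y) e → x≢y (inj px py e) }) (pxs , x∉)) ∷ map-unique inj xs pxs xs!

-- Injectivity is asked only on `P`: cutting a matrix into its two upper blocks is injective on the
-- nilradical but need not be so on all matrices.
count-≤ : {A B : Set} {P : A → Set} {Q : B → Set} (P? : ∀ x → Dec (P x)) (Q? : ∀ y → Dec (Q y))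
  {xs : List A} {ys : List B} → Unique xs → (∀ y → y ∈ ys) → (f : A → B) →
  (∀ {x y} → P x → P y → f x ≡ f y → x ≡ y) → (∀ {x} → P x → Q (f x)) → count P? xs ≤ count Q? ys
count-≤ P? Q? {xs} {ys} xs! all f inj pres =
  subst (_≤ count Q? ys) (ListP.length-map f (List.filter P? xs))
    (unique-⊆⇒length≤ _ _ (map-unique inj _ (AllP.all-filter P? xs) (UniqueP.filter⁺ P? xs!)) member)
  where
  member : ∀ {y} → y ∈ List.map f (List.filter P? xs) → y ∈ List.filter Q? ys
  member p with x , q , refl ← ∈P.∈-map⁻ f p = ∈P.∈-filter⁺ Q? (all _) (pres (proj₂ (∈P.∈-filter⁻ P? {xs = xs} q)))

indicator : {P : Set} → Dec P → ℕ
indicator P? = if does P? then 1 else 0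

count-∷ : {A : Set} {P : A → Set} (P? : ∀ x → Dec (P x)) → ∀ x xs → count P? (x ∷ xs) ≡ indicator (P? x) ℕ.+ count P? xs
count-∷ P? x xs with does (P? x)
... | true  = refl
... | false = refl

indicator-yes : {P : Set} (P? : Dec P) → P → indicator P? ≡ 1
indicator-yes (yes _) p = refl
indicator-yes (no ¬p) p = ⊥-elim (¬p p)

indicator-no : {P : Set} (P? : Dec P) → ¬ P → indicator P? ≡ 0
indicator-no (yes p) ¬p = ⊥-elim (¬p p)
indicator-no (no _)  ¬p = refl

count-none : {A : Set} {P : A → Set} (P? : ∀ x → Dec (P x)) → ∀ xs → (∀ x → ¬ P x) → count P? xs ≡ 0
count-none P? []       none = refl
count-none P? (x ∷ xs) none =
  trans (count-∷ P? x xs) (cong₂ ℕ._+_ (indicator-no (P? x) (none x)) (count-none P? xs none))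

count-cong : {A : Set} {P Q : A → Set} (P? : ∀ x → Dec (P x)) (Q? : ∀ x → Dec (Q x)) →
  (∀ {x} → P x → Q x) → (∀ {x} → Q x → P x) → ∀ xs → count P? xs ≡ count Q? xs
count-cong P? Q? to from xs = cong length (ListP.filter-≐ P? Q? (to , from) xs)

count-map : {A B : Set} {P : B → Set} (P? : ∀ y → Dec (P y)) (f : A → B) → ∀ xs →
  count P? (List.map f xs) ≡ count (λ x → P? (f x)) xs
count-map P? f []       = refl
count-map P? f (x ∷ xs) = trans (count-∷ P? (f x) (List.map f xs))
  (trans (cong (indicator (P? (f x)) ℕ.+_) (count-map P? f xs)) (sym (count-∷ (λ x → P? (f x)) x xs)))

count-++ : {A : Set} {P : A → Set} (P? : ∀ x → Dec (P x)) → ∀ xs ys → count P? (xs List.++ ys) ≡ count P? xs ℕ.+ count P? ys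
count-++ P? xs ys = trans (cong length (ListP.filter-++ P? xs ys)) (ListP.length-++ (List.filter P? xs))

-- The fibre over an `x` with `P x` has size `g` and every other fibre is empty, so each `x`
-- contributes `g` times an indicator.
count-cartesianProduct : {A B : Set} {P : A → Set} {R : A × B → Set} (P? : ∀ x → Dec (P x)) (R? : ∀ z → Dec (R z))
  (ys : List B) (g : ℕ) → (∀ x → P x → count (λ y → R? (x , y)) ys ≡ g) →
  ∀ xs → count (λ z → P? (proj₁ z) ×-dec R? z) (List.cartesianProduct xs ys) ≡ g ℕ.* count P? xs
count-cartesianProduct P? R? ys g fibre []       = sym (ℕP.*-zeroʳ g)
count-cartesianProduct P? R? ys g fibre (x ∷ xs) = begin
  count S? (List.map (x ,_) ys List.++ List.cartesianProduct xs ys)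
    ≡⟨ count-++ S? (List.map (x ,_) ys) _ ⟩
  count S? (List.map (x ,_) ys) ℕ.+ count S? (List.cartesianProduct xs ys)
    ≡⟨ cong₂ ℕ._+_ (trans (count-map S? (x ,_) ys) (slice (P? x))) (count-cartesianProduct P? R? ys g fibre xs) ⟩
  g ℕ.* indicator (P? x) ℕ.+ g ℕ.* count P? xs
    ≡⟨ ℕP.*-distribˡ-+ g (indicator (P? x)) (count P? xs) ⟨
  g ℕ.* (indicator (P? x) ℕ.+ count P? xs)
    ≡⟨ cong (g ℕ.*_) (count-∷ P? x xs) ⟨
  g ℕ.* count P? (x ∷ xs) ∎
  where
  open ≡-Reasoning
  S? = λ z → P? (proj₁ z) ×-dec R? z
  slice : (d : Dec _) → count (λ y → P? x ×-dec R? (x , y)) ys ≡ g ℕ.* indicator d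
  slice (yes p) = trans (count-cong _ _ proj₂ (p ,_) ys) (trans (fibre x p) (sym (ℕP.*-identityʳ g)))
  slice (no ¬p) = trans (count-none _ ys (λ _ → ¬p ∘ proj₁)) (sym (ℕP.*-zeroʳ g))

sum-map-+ : {A : Set} (f g : A → ℕ) → ∀ xs →
  sumL (List.map (λ x → f x ℕ.+ g x) xs) ≡ sumL (List.map f xs) ℕ.+ sumL (List.map g xs)
sum-map-+ f g []       = refl
sum-map-+ f g (x ∷ xs) = trans (cong (f x ℕ.+ g x ℕ.+_) (sum-map-+ f g xs)) (ℕ-interchange (f x) (g x) _ _)

sum-map-zero : {A : Set} (f : A → ℕ) → ∀ xs → (∀ {x} → x ∈ xs → f x ≡ 0) → sumL (List.map f xs) ≡ 0
sum-map-zero f []       e = refl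
sum-map-zero f (x ∷ xs) e = cong₂ ℕ._+_ (e (here refl)) (sum-map-zero f xs (e ∘ there))

sum-map-single : {A : Set} (f : A → ℕ) → ∀ {x} xs → Unique xs → x ∈ xs → f x ≡ 1 →
  (∀ {y} → y ∈ xs → ¬ y ≡ x → f y ≡ 0) → sumL (List.map f xs) ≡ 1
sum-map-single f (x ∷ xs) (x∉ ∷ _)   (here refl) e z =
  cong₂ ℕ._+_ e (sum-map-zero f xs λ q → z (there q) λ { refl → All.lookup x∉ q refl })
sum-map-single f (y ∷ xs) (y∉ ∷ xs!) (there p)   e z =
  cong₂ ℕ._+_ (z (here refl) λ { refl → All.lookup y∉ p refl }) (sum-map-single f xs xs! p e (z ∘ there))

-- Double counting: for fixed `x` the indicators of the classes add up to the indicator of `P x`,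
-- since `cover` gives at least one class and `disj` at most one.
count-partition : {A I : Set} {P : A → Set} {Q : I → A → Set} (P? : ∀ x → Dec (P x)) (Q? : ∀ i x → Dec (Q i x))
  (is : List I) → Unique is → (∀ {x} → P x → ∃ λ i → i ∈ is × Q i x) → (∀ {i x} → i ∈ is → Q i x → P x) →
  (∀ {i j x} → i ∈ is → j ∈ is → Q i x → Q j x → i ≡ j) →
  ∀ xs → count P? xs ≡ sumL (List.map (λ i → count (Q? i) xs) is)
count-partition P? Q? is is! cover sub disj []       = sym (sum-map-zero _ is λ _ → refl)
count-partition P? Q? is is! cover sub disj (x ∷ xs) = begin
  count P? (x ∷ xs)
    ≡⟨ count-∷ P? x xs ⟩
  indicator (P? x) ℕ.+ count P? xs
    ≡⟨ cong₂ ℕ._+_ (sym (column (P? x))) (count-partition P? Q? is is! cover sub disj xs) ⟩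
  sumL (List.map (λ i → indicator (Q? i x)) is) ℕ.+ sumL (List.map (λ i → count (Q? i) xs) is)
    ≡⟨ sum-map-+ _ _ is ⟨
  sumL (List.map (λ i → indicator (Q? i x) ℕ.+ count (Q? i) xs) is)
    ≡⟨ cong sumL (ListP.map-cong (λ i → sym (count-∷ (Q? i) x xs)) is) ⟩
  sumL (List.map (λ i → count (Q? i) (x ∷ xs)) is) ∎
  where
  open ≡-Reasoning
  column : (d : Dec _) → sumL (List.map (λ i → indicator (Q? i x)) is) ≡ indicator d
  column (no ¬p) = sum-map-zero _ is λ {i} i∈ → indicator-no (Q? i x) (¬p ∘ sub i∈)
  column (yes p) with i , i∈ , q ← cover p =
    sum-map-single _ is is! i∈ (indicator-yes (Q? i x) q) λ {j} j∈ j≢i → indicator-no (Q? j x) λ q′ → j≢i (disj j∈ i∈ q′ q)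

allVecs-unique : {A : Set} {xs : List A} → Unique xs → ∀ k → Unique (allVecs xs k)
allVecs-unique xs! zero    = [] ∷ []
allVecs-unique xs! (suc k) = UniqueP.cartesianProductWith⁺ _∷_ VecP.∷-injective xs! (allVecs-unique xs! k)

-- Coordinate vectors and linear maps

module _ (𝔽 : FiniteField) where

  open FiniteField 𝔽

  commutativeRing : CommutativeRing 0ℓ 0ℓ
  commutativeRing = record { isCommutativeRing = isCommutativeRing }

  open CommutativeRing commutativeRing
    using (+-identityˡ; +-identityʳ; +-comm; +-assoc; *-comm; *-assoc; *-identityˡ; *-identityʳ
          ; zeroˡ; zeroʳ; distribˡ; distribʳ; -‿inverseˡ; semiring; +-commutativeMonoid; +-commutativeSemigroup; *-commutativeSemigroup)
  open import Algebra.Properties.CommutativeMonoid.Sum +-commutativeMonoid using (sum; ∑-comm; sum-cong-≗)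
  open import Algebra.Properties.Semiring.Sum semiring using (*-distribˡ-sum; *-distribʳ-sum)

  open import Algebra.Properties.CommutativeSemigroup +-commutativeSemigroup using () renaming (interchange to +-interchange)
  open import Algebra.Properties.CommutativeSemigroup *-commutativeSemigroup using (x∙yz≈y∙xz; xy∙z≈x∙zy)

  V : ℕ → Set
  V = Vec Carrier

  infixl 6 _+ᵥ_
  infixl 7 _∙ᵥ_

  _+ᵥ_ : ∀ {n} → V n → V n → V n
  _+ᵥ_ = zipWith _+_

  _∙ᵥ_ : ∀ {n} → Carrier → V n → V n
  c ∙ᵥ x = Vec.map (c *_) x

  0ᵥ : ∀ {n} → V n
  0ᵥ = replicate _ 0#

  private
    variable
      a b c d k m n ℓ : ℕ

  0∙ : (x : V n) → 0# ∙ᵥ x ≡ 0ᵥ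
  0∙ []      = refl
  0∙ (x ∷ v) = cong₂ _∷_ (zeroˡ x) (0∙ v)

  ∙0 : ∀ k → k ∙ᵥ 0ᵥ {n} ≡ 0ᵥ
  ∙0 {n} k = trans (VecP.map-replicate (k *_) 0# n) (cong (replicate n) (zeroʳ k))

  1∙ : (x : V n) → 1# ∙ᵥ x ≡ x
  1∙ x = trans (VecP.map-cong *-identityˡ x) (VecP.map-id x)

  ∙∙ : ∀ k l (x : V n) → k ∙ᵥ (l ∙ᵥ x) ≡ (k * l) ∙ᵥ x
  ∙∙ k l []      = refl
  ∙∙ k l (x ∷ v) = cong₂ _∷_ (sym (*-assoc k l x)) (∙∙ k l v)

  ∙-distrib : ∀ k (x y : V n) → k ∙ᵥ (x +ᵥ y) ≡ k ∙ᵥ x +ᵥ k ∙ᵥ y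
  ∙-distrib k []      []      = refl
  ∙-distrib k (x ∷ v) (y ∷ w) = cong₂ _∷_ (distribˡ k x y) (∙-distrib k v w)

  +-∙ : ∀ k l (x : V n) → (k + l) ∙ᵥ x ≡ k ∙ᵥ x +ᵥ l ∙ᵥ x
  +-∙ k l []      = refl
  +-∙ k l (x ∷ v) = cong₂ _∷_ (distribʳ x k l) (+-∙ k l v)

  +ᵥ-identityˡ : (x : V n) → 0ᵥ +ᵥ x ≡ x
  +ᵥ-identityˡ = VecP.zipWith-identityˡ +-identityˡ

  +ᵥ-identityʳ : (x : V n) → x +ᵥ 0ᵥ ≡ x
  +ᵥ-identityʳ = VecP.zipWith-identityʳ +-identityʳ

  +ᵥ-assoc : (x y z : V n) → (x +ᵥ y) +ᵥ z ≡ x +ᵥ (y +ᵥ z)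
  +ᵥ-assoc = VecP.zipWith-assoc +-assoc

  +ᵥ-comm : (x y : V n) → x +ᵥ y ≡ y +ᵥ x
  +ᵥ-comm = VecP.zipWith-comm +-comm

  +ᵥ-interchange : (p q r s : V n) → (p +ᵥ q) +ᵥ (r +ᵥ s) ≡ (p +ᵥ r) +ᵥ (q +ᵥ s)
  +ᵥ-interchange []      []      []      []      = refl
  +ᵥ-interchange (p ∷ P) (q ∷ Q) (r ∷ R) (s ∷ S) =
    cong₂ _∷_ (+-interchange p q r s) (+ᵥ-interchange P Q R S)

  neg-scale : ∀ k s → - k * s + k * s ≡ 0#
  neg-scale k s = trans (sym (distribʳ s (- k) k)) (trans (cong (_* s) (-‿inverseˡ k)) (zeroˡ s))

  neg-cancel : ∀ k (x : V n) → - k ∙ᵥ x +ᵥ k ∙ᵥ x ≡ 0ᵥ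
  neg-cancel k []      = refl
  neg-cancel k (s ∷ x) = cong₂ _∷_ (neg-scale k s) (neg-cancel k x)

  neg-unique : (x y : V n) → x +ᵥ y ≡ 0ᵥ → x ≡ - 1# ∙ᵥ y
  neg-unique x y e = begin
    x                                    ≡⟨ +ᵥ-identityʳ x ⟨
    x +ᵥ 0ᵥ                              ≡⟨ cong (x +ᵥ_) (trans (+ᵥ-comm _ _) (neg-cancel 1# y)) ⟨
    x +ᵥ (1# ∙ᵥ y +ᵥ - 1# ∙ᵥ y)          ≡⟨ +ᵥ-assoc _ _ _ ⟨
    (x +ᵥ 1# ∙ᵥ y) +ᵥ - 1# ∙ᵥ y          ≡⟨ cong (λ u → (x +ᵥ u) +ᵥ - 1# ∙ᵥ y) (1∙ y) ⟩
    (x +ᵥ y) +ᵥ - 1# ∙ᵥ y                ≡⟨ cong (_+ᵥ - 1# ∙ᵥ y) e ⟩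
    0ᵥ +ᵥ - 1# ∙ᵥ y                      ≡⟨ +ᵥ-identityˡ _ ⟩
    - 1# ∙ᵥ y                            ∎
    where open ≡-Reasoning

  ∙-cancel : ∀ {p q} → p * q ≡ 1# → (x : V n) → p ∙ᵥ (q ∙ᵥ x) ≡ x
  ∙-cancel {p = p} {q} e x = trans (∙∙ p q x) (trans (cong (_∙ᵥ x) e) (1∙ x))

  ++-zero : ∀ a → 0ᵥ {a} Vec.++ 0ᵥ {b} ≡ 0ᵥ
  ++-zero zero    = refl
  ++-zero (suc a) = cong (0# ∷_) (++-zero a)

  ++-+ : (x y : V a) (u v : V b) → (x Vec.++ u) +ᵥ (y Vec.++ v) ≡ (x +ᵥ y) Vec.++ (u +ᵥ v)
  ++-+ x y u v = VecP.zipWith-++ _+_ x u y v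

  ++-∙ : ∀ k (x : V a) (u : V b) → k ∙ᵥ (x Vec.++ u) ≡ (k ∙ᵥ x) Vec.++ (k ∙ᵥ u)
  ++-∙ k x u = VecP.map-++ (k *_) x u

  take-++ : (x : V a) (y : V b) → Vec.take a (x Vec.++ y) ≡ x
  take-++ {a} x y = VecP.++-injectiveˡ _ x (VecP.take++drop≡id a (x Vec.++ y))

  drop-++ : (x : V a) (y : V b) → Vec.drop a (x Vec.++ y) ≡ y
  drop-++ {a} x y = VecP.++-injectiveʳ _ x (VecP.take++drop≡id a (x Vec.++ y))

  record Linear (f : V a → V b) : Set where
    field
      add   : ∀ x y → f (x +ᵥ y) ≡ f x +ᵥ f y
      scale : ∀ k x → f (k ∙ᵥ x) ≡ k ∙ᵥ f x

    zero-map : f 0ᵥ ≡ 0ᵥ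
    zero-map = trans (cong f (sym (0∙ 0ᵥ))) (trans (scale 0# 0ᵥ) (0∙ _))

  open Linear

  Injective₀ : (V a → V b) → Set
  Injective₀ f = ∀ x → f x ≡ 0ᵥ → x ≡ 0ᵥ

  lin-id : Linear {n} id
  lin-id .add x y   = refl
  lin-id .scale k x = refl

  lin-∘ : {f : V b → V c} {g : V a → V b} → Linear f → Linear g → Linear (f ∘ g)
  lin-∘ {f = f} lf lg .add x y   = trans (cong f (lg .add x y)) (lf .add _ _)
  lin-∘ {f = f} lf lg .scale k x = trans (cong f (lg .scale k x)) (lf .scale k _)

  lin-+ : {f g : V a → V b} → Linear f → Linear g → Linear (λ x → f x +ᵥ g x)
  lin-+ lf lg .add x y   = trans (cong₂ _+ᵥ_ (lf .add x y) (lg .add x y)) (+ᵥ-interchange _ _ _ _)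
  lin-+ lf lg .scale k x = trans (cong₂ _+ᵥ_ (lf .scale k x) (lg .scale k x)) (sym (∙-distrib k _ _))

  lin-++ : {f : V a → V b} {g : V a → V c} → Linear f → Linear g → Linear (λ x → f x Vec.++ g x)
  lin-++ {f = f} {g} lf lg .add x y   =
    trans (cong₂ Vec._++_ (lf .add x y) (lg .add x y)) (sym (++-+ (f x) (f y) (g x) (g y)))
  lin-++ {f = f} {g} lf lg .scale k x =
    trans (cong₂ Vec._++_ (lf .scale k x) (lg .scale k x)) (sym (++-∙ k (f x) (g x)))

  lin-0 : Linear {a} {b} (λ _ → 0ᵥ)
  lin-0 .add x y   = sym (+ᵥ-identityˡ 0ᵥ)
  lin-0 .scale k x = sym (∙0 k)

  lin-take : ∀ a → Linear {a ℕ.+ b} (Vec.take a)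
  lin-take a .add x y   = VecP.take-zipWith _+_ x y
  lin-take a .scale k x = VecP.take-map (k *_) a x

  lin-drop : ∀ a → Linear {a ℕ.+ b} (Vec.drop a)
  lin-drop a .add x y   = VecP.drop-zipWith _+_ x y
  lin-drop a .scale k x = VecP.drop-map (k *_) a x

  lin-tail : Linear {suc n} tail
  lin-tail .add   (_ ∷ _) (_ ∷ _) = refl
  lin-tail .scale k (_ ∷ _)       = refl

  lin-head-∙ : (v : V b) → Linear {suc n} (λ y → head y ∙ᵥ v)
  lin-head-∙ v .add   (s ∷ _) (t ∷ _) = +-∙ s t v
  lin-head-∙ v .scale k (s ∷ _)       = sym (∙∙ k s v)

  lin-0∷ : Linear {n} (0# ∷_)
  lin-0∷ .add x y   = cong (_∷ _) (sym (+-identityˡ 0#))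
  lin-0∷ .scale k x = cong (_∷ _) (sym (zeroʳ k))

  ∷-split : ∀ {f : V (suc n) → V b} → Linear f → ∀ s x → f (s ∷ x) ≡ s ∙ᵥ f (1# ∷ 0ᵥ) +ᵥ f (0# ∷ x)
  ∷-split {f = f} lf s x = begin
    f (s ∷ x)                              ≡⟨ cong f (cong₂ _∷_ e₁ e₂) ⟨
    f (s ∙ᵥ (1# ∷ 0ᵥ) +ᵥ (0# ∷ x))         ≡⟨ lf .add _ _ ⟩
    f (s ∙ᵥ (1# ∷ 0ᵥ)) +ᵥ f (0# ∷ x)       ≡⟨ cong (_+ᵥ f (0# ∷ x)) (lf .scale s _) ⟩
    s ∙ᵥ f (1# ∷ 0ᵥ) +ᵥ f (0# ∷ x)         ∎
    where
    open ≡-Reasoning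
    e₁ : s * 1# + 0# ≡ s
    e₁ = trans (+-identityʳ _) (trans (*-comm s 1#) (*-identityˡ s))
    e₂ : s ∙ᵥ 0ᵥ +ᵥ x ≡ x
    e₂ = trans (cong (_+ᵥ x) (∙0 s)) (+ᵥ-identityˡ x)

  -- Homogeneous linear equations and comparison of dimensions

  head-+ : (x y : V (suc n)) → head (x +ᵥ y) ≡ head x + head y
  head-+ (_ ∷ _) (_ ∷ _) = refl

  head-∙ : ∀ k (x : V (suc n)) → head (k ∙ᵥ x) ≡ k * head x
  head-∙ k (_ ∷ _) = refl

  -- The kernel of the functional `head ∘ f` is parametrised with one coordinate fewer. If the
  -- functional kills the first basis vector, that coordinate stays free and the recursion treats
  -- the others; otherwise the equation is solved for the first coordinate.
  hyperplane : (f : V (suc n) → V (suc b)) → Linear f →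
    Σ (V n → V (suc n)) λ κ → Linear κ × Injective₀ κ × (∀ x → head (f (κ x)) ≡ 0#)
  hyperplane {n} f lf with head (f (1# ∷ 0ᵥ)) ≟ 0#
  hyperplane {zero} f lf | yes p =
    (λ _ → 0ᵥ) , lin-0 , (λ { [] _ → refl }) , λ _ → cong head (zero-map lf)
  hyperplane {suc n} f lf | yes p
    with κ , lκ , iκ , zκ ← hyperplane (f ∘ (0# ∷_)) (lin-∘ lf lin-0∷)
    = (λ { (s ∷ x) → s ∷ κ x })
    , record { add   = λ { (s ∷ x) (t ∷ y) → cong (s + t ∷_) (lκ .add x y) }
             ; scale = λ { k (s ∷ x) → cong (k * s ∷_) (lκ .scale k x) } }
    , (λ { (s ∷ x) e → cong₂ _∷_ (cong head e) (iκ x (cong tail e)) })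
    , λ { (s ∷ x) → begin
        head (f (s ∷ κ x))                                 ≡⟨ cong head (∷-split lf s (κ x)) ⟩
        head (s ∙ᵥ f (1# ∷ 0ᵥ) +ᵥ f (0# ∷ κ x))            ≡⟨ head-+ (s ∙ᵥ f (1# ∷ 0ᵥ)) _ ⟩
        head (s ∙ᵥ f (1# ∷ 0ᵥ)) + head (f (0# ∷ κ x))      ≡⟨ cong₂ _+_ (head-∙ s (f (1# ∷ 0ᵥ))) (zκ x) ⟩
        s * head (f (1# ∷ 0ᵥ)) + 0#                        ≡⟨ cong (λ h → s * h + 0#) p ⟩
        s * 0# + 0#                                        ≡⟨ trans (+-identityʳ _) (zeroʳ s) ⟩
        0#                                                 ∎ }
    where open ≡-Reasoning
  -- `p` is the nonzero coefficient of the first coordinate and `q` its inverse, so that coordinate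
  -- has to be `- q * φ x`.
  hyperplane {n} f lf | no p≢0 with q , pq≡1 ← inverse _ p≢0
    = κ
    , record { add   = λ x y → cong (_∷ (x +ᵥ y)) (trans (cong (- q *_) (φ-+ x y)) (distribˡ (- q) (φ x) (φ y)))
             ; scale = λ k x → cong (_∷ (k ∙ᵥ x)) (trans (cong (- q *_) (φ-∙ k x)) (x∙yz≈y∙xz (- q) k (φ x))) }
    , (λ x e → cong tail e)
    , λ x → begin
        head (f (κ x))                                     ≡⟨ cong head (∷-split lf (- q * φ x) x) ⟩
        head ((- q * φ x) ∙ᵥ f (1# ∷ 0ᵥ) +ᵥ f (0# ∷ x))    ≡⟨ head-+ ((- q * φ x) ∙ᵥ f (1# ∷ 0ᵥ)) _ ⟩
        head ((- q * φ x) ∙ᵥ f (1# ∷ 0ᵥ)) + φ x            ≡⟨ cong (_+ φ x) (head-∙ (- q * φ x) (f (1# ∷ 0ᵥ))) ⟩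
        (- q * φ x) * p + φ x                              ≡⟨ cong₂ _+_ (xy∙z≈x∙zy (- q) (φ x) p) (sym (*-identityˡ _)) ⟩
        - q * (p * φ x) + 1# * φ x                         ≡⟨ cong (λ u → - q * (p * φ x) + u * φ x) (trans (sym pq≡1) (*-comm p q)) ⟩
        - q * (p * φ x) + (q * p) * φ x                    ≡⟨ cong (- q * (p * φ x) +_) (*-assoc q p (φ x)) ⟩
        - q * (p * φ x) + q * (p * φ x)                    ≡⟨ neg-scale q (p * φ x) ⟩
        0#                                                 ∎
    where
    open ≡-Reasoning
    p = head (f (1# ∷ 0ᵥ))
    φ : V n → Carrier
    φ x = head (f (0# ∷ x))
    φ-+ : ∀ x y → φ (x +ᵥ y) ≡ φ x + φ y
    φ-+ x y = trans (cong head (lin-∘ lf lin-0∷ .add x y)) (head-+ (f (0# ∷ x)) _)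
    φ-∙ : ∀ k x → φ (k ∙ᵥ x) ≡ k * φ x
    φ-∙ k x = trans (cong head (lin-∘ lf lin-0∷ .scale k x)) (head-∙ k (f (0# ∷ x)))
    κ : V n → V (suc n)
    κ x = - q * φ x ∷ x

  -- The inequality half of rank-nullity: each of the `n` equations is restricted to the solutions
  -- of the earlier ones and costs one coordinate.
  kernel : ∀ n (f : V (n ℕ.+ c) → V n) → Linear f →
    Σ (V c → V (n ℕ.+ c)) λ ι → Linear ι × Injective₀ ι × (∀ x → f (ι x) ≡ 0ᵥ)
  kernel zero    f lf = id , lin-id , (λ _ e → e) , λ x → empty (f x)
    where
    empty : (y : V 0) → y ≡ []
    empty [] = refl
  kernel (suc n) f lf
    with κ , lκ , iκ , zκ ← hyperplane f lf
    with ι , lι , iι , zι ← kernel n (tail ∘ f ∘ κ) (lin-∘ lin-tail (lin-∘ lf lκ))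
    = κ ∘ ι , lin-∘ lκ lι , (λ x e → iι x (iκ (ι x) e)) , λ x → ∷-ext (f (κ (ι x))) (zκ (ι x)) (zι x)
    where
    ∷-ext : ∀ {n} (y : V (suc n)) → head y ≡ 0# → tail y ≡ 0ᵥ → y ≡ 0ᵥ
    ∷-ext (_ ∷ _) = cong₂ _∷_

  nontrivial-kernel : ∀ {k} (f : V k → V n) → Linear f → n < k → ∃ λ x → f x ≡ 0ᵥ × ¬ x ≡ 0ᵥ
  nontrivial-kernel {n} f lf n<k
    with o , refl ← ℕP.m≤n⇒∃[o]m+o≡n (ℕP.<⇒≤ n<k)
    with o
  ... | zero  = ⊥-elim (ℕP.n≮n n (subst (n <_) (ℕP.+-identityʳ n) n<k))
  ... | suc o with ι , lι , iι , zι ← kernel n f lf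
    = ι (1# ∷ 0ᵥ) , zι _ , λ e → 0≢1 (sym (cong head (iι _ e)))

  injective⇒≤ : (f : V a → V b) → Linear f → Injective₀ f → a ≤ b
  injective⇒≤ {a} {b} f lf inj with a ℕP.≤? b
  ... | yes a≤b = a≤b
  ... | no  a≰b with x , fx≡0 , x≢0 ← nontrivial-kernel f lf (ℕP.≰⇒> a≰b) = ⊥-elim (x≢0 (inj x fx≡0))

  leftInverse⇒injective : {f : V a → V b} {g : V b → V a} → Linear g → (∀ x → g (f x) ≡ x) → Injective₀ f
  leftInverse⇒injective {g = g} lg gf x e = trans (sym (gf x)) (trans (cong g e) (zero-map lg))

  -- `Conj` records only g h = 1, so the other product must come from dimension. The map (s , x) to
  -- s v + h x goes from `suc n` to `n` coordinates and has a nonzero kernel vector; its `s` is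
  -- nonzero because `h` is injective, and hence every `v` lies in the image of `h`.
  leftInverse⇒rightInverse : {g h : V n → V n} → Linear g → Linear h → (∀ x → g (h x) ≡ x) → ∀ x → h (g x) ≡ x
  leftInverse⇒rightInverse {n} {g} {h} lg lh gh v =
    trans (cong (h ∘ g) (proj₂ v-in-image)) (trans (cong h (gh _)) (sym (proj₂ v-in-image)))
    where
    f : V (suc n) → V n
    f y = head y ∙ᵥ v +ᵥ h (tail y)
    lf : Linear f
    lf = lin-+ (lin-head-∙ v) (lin-∘ lh lin-tail)
    v-in-image : ∃ λ u → v ≡ h u
    v-in-image with nontrivial-kernel f lf ℕP.≤-refl
    ... | (s ∷ x) , e , ne with s ≟ 0#
    ...   | yes refl = ⊥-elim (ne (cong (0# ∷_) (leftInverse⇒injective lg gh x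
                         (trans (sym (+ᵥ-identityˡ _)) (trans (cong (_+ᵥ h x) (sym (0∙ v))) e)))))
    ...   | no s≢0 with t , st≡1 ← inverse s s≢0 = t ∙ᵥ (- 1# ∙ᵥ x) , (begin
      v                        ≡⟨ ∙-cancel (trans (*-comm t s) st≡1) v ⟨
      t ∙ᵥ (s ∙ᵥ v)            ≡⟨ cong (t ∙ᵥ_) (neg-unique _ _ e) ⟩
      t ∙ᵥ (- 1# ∙ᵥ h x)       ≡⟨ cong (t ∙ᵥ_) (lh .scale _ x) ⟨
      t ∙ᵥ h (- 1# ∙ᵥ x)       ≡⟨ lh .scale t _ ⟨
      h (t ∙ᵥ (- 1# ∙ᵥ x))     ∎)
      where open ≡-Reasoning

  -- Matrices as operators

  Matrix : ℕ → ℕ → Set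
  Matrix = Mat 𝔽

  infixr 7 _*ᵥ_
  infixl 7 _·ₘ_

  _·ₘ_ : Matrix a b → Matrix b c → Matrix a c
  _·ₘ_ = _·_ 𝔽

  -- Recursive rather than through `sumF`, so that linearity and extensionality go by induction
  -- along the row; `dot≡sum` reconciles it with the entrywise product.
  dot : V n → V n → Carrier
  dot []      []      = 0#
  dot (r ∷ R) (x ∷ X) = r * x + dot R X

  _*ᵥ_ : Matrix a b → V b → V a
  X *ᵥ x = Vec.map (λ r → dot r x) X

  dot-+ : (r x y : V n) → dot r (x +ᵥ y) ≡ dot r x + dot r y
  dot-+ []      []      []      = sym (+-identityˡ 0#)
  dot-+ (r ∷ R) (x ∷ X) (y ∷ Y) = trans (cong₂ _+_ (distribˡ r x y) (dot-+ R X Y)) (+-interchange _ _ _ _)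

  dot-∙ : ∀ k (r x : V n) → dot r (k ∙ᵥ x) ≡ k * dot r x
  dot-∙ k []      []      = sym (zeroʳ k)
  dot-∙ k (r ∷ R) (x ∷ X) = trans (cong₂ _+_ (x∙yz≈y∙xz r k x) (dot-∙ k R X)) (sym (distribˡ k _ _))

  *ᵥ-linear : (X : Matrix a b) → Linear (X *ᵥ_)
  *ᵥ-linear []      .add x y   = refl
  *ᵥ-linear (r ∷ X) .add x y   = cong₂ _∷_ (dot-+ r x y) (*ᵥ-linear X .add x y)
  *ᵥ-linear []      .scale k x = refl
  *ᵥ-linear (r ∷ X) .scale k x = cong₂ _∷_ (dot-∙ k r x) (*ᵥ-linear X .scale k x)

  dot-zero : (r : V n) → dot r 0ᵥ ≡ 0#
  dot-zero r = trans (cong (dot r) (sym (0∙ 0ᵥ))) (trans (dot-∙ 0# r 0ᵥ) (zeroˡ _))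

  dot-head : ∀ s (r : V n) → dot (s ∷ r) (1# ∷ 0ᵥ) ≡ s
  dot-head s r = trans (cong₂ _+_ (trans (*-comm s 1#) (*-identityˡ s)) (dot-zero r)) (+-identityʳ s)

  dot-tail : ∀ s (r x : V n) → dot (s ∷ r) (0# ∷ x) ≡ dot r x
  dot-tail s r x = trans (cong (_+ dot r x) (zeroʳ s)) (+-identityˡ _)

  dot-ext : (r s : V n) → (∀ x → dot r x ≡ dot s x) → r ≡ s
  dot-ext []      []      e = refl
  dot-ext (p ∷ r) (q ∷ s) e = cong₂ _∷_
    (trans (sym (dot-head p r)) (trans (e (1# ∷ 0ᵥ)) (dot-head q s)))
    (dot-ext r s λ x → trans (sym (dot-tail p r x)) (trans (e (0# ∷ x)) (dot-tail q s x)))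

  matrix-ext : (X Y : Matrix a b) → (∀ x → X *ᵥ x ≡ Y *ᵥ x) → X ≡ Y
  matrix-ext []      []      e = refl
  matrix-ext (r ∷ X) (s ∷ Y) e = cong₂ _∷_ (dot-ext r s λ x → cong head (e x)) (matrix-ext X Y λ x → cong tail (e x))

  toMatrix : (V b → V a) → Matrix a b
  toMatrix {zero}  f = replicate _ []
  toMatrix {suc b} f = zipWith _∷_ (f (1# ∷ 0ᵥ)) (toMatrix (f ∘ (0# ∷_)))

  column-*ᵥ : (v : V a) (X : Matrix a b) (s : Carrier) (x : V b) → zipWith _∷_ v X *ᵥ (s ∷ x) ≡ s ∙ᵥ v +ᵥ X *ᵥ x
  column-*ᵥ []      []      s x = refl
  column-*ᵥ (t ∷ v) (r ∷ X) s x = cong₂ _∷_ (cong (_+ dot r x) (*-comm t s)) (column-*ᵥ v X s x)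

  toMatrix-*ᵥ : (f : V b → V a) → Linear f → ∀ x → toMatrix f *ᵥ x ≡ f x
  toMatrix-*ᵥ {a = a} f lf []      = trans (VecP.map-replicate _ [] a) (sym (zero-map lf))
  toMatrix-*ᵥ         f lf (s ∷ x) =
    trans (column-*ᵥ (f (1# ∷ 0ᵥ)) (toMatrix (f ∘ (0# ∷_))) s x)
          (trans (cong (s ∙ᵥ f (1# ∷ 0ᵥ) +ᵥ_) (toMatrix-*ᵥ (f ∘ (0# ∷_)) (lin-∘ lf lin-0∷) x))
                 (sym (∷-split lf s x)))

  sumF≡sum : (f : Fin n → Carrier) → sumF 𝔽 f ≡ sum f
  sumF≡sum {zero}  f = refl
  sumF≡sum {suc n} f = cong (f Fin.zero +_) (sumF≡sum (f ∘ Fin.suc))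

  dot≡sum : (r x : V n) → dot r x ≡ sum (λ j → lookup r j * lookup x j)
  dot≡sum []      []      = refl
  dot≡sum (r ∷ R) (x ∷ X) = cong (r * x +_) (dot≡sum R X)

  lookup-ext : (x y : V n) → (∀ i → lookup x i ≡ lookup y i) → x ≡ y
  lookup-ext x y e = trans (sym (VecP.tabulate∘lookup x)) (trans (VecP.tabulate-cong e) (VecP.tabulate∘lookup y))

  lookup-*ᵥ : (X : Matrix a b) (x : V b) (i : Fin a) → lookup (X *ᵥ x) i ≡ sum (λ j → entry 𝔽 X i j * lookup x j)
  lookup-*ᵥ X x i = trans (VecP.lookup-map i _ X) (dot≡sum (lookup X i) x)

  entry-tabulate : (f : Fin a → Fin b → Carrier) → ∀ i j → entry 𝔽 (tabulate λ i → tabulate (f i)) i j ≡ f i j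
  entry-tabulate f i j = trans (cong (λ r → lookup r j) (VecP.lookup∘tabulate (λ i → tabulate (f i)) i)) (VecP.lookup∘tabulate (f i) j)

  tabulate-*ᵥ : (f : Fin a → Fin b → Carrier) (x : V b) → ∀ i →
    lookup ((tabulate λ i → tabulate (f i)) *ᵥ x) i ≡ sum (λ j → f i j * lookup x j)
  tabulate-*ᵥ f x i = trans (lookup-*ᵥ (tabulate λ i → tabulate (f i)) x i)
                            (sum-cong-≗ λ j → cong (_* lookup x j) (entry-tabulate f i j))

  ·-*ᵥ : (X : Matrix a b) (Y : Matrix b c) → ∀ x → (X ·ₘ Y) *ᵥ x ≡ X *ᵥ (Y *ᵥ x)
  ·-*ᵥ X Y x = lookup-ext _ _ λ i → begin
    lookup ((X ·ₘ Y) *ᵥ x) i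
      ≡⟨ tabulate-*ᵥ _ x i ⟩
    sum (λ j → sumF 𝔽 (λ k → entry 𝔽 X i k * entry 𝔽 Y k j) * lookup x j)
      ≡⟨ sum-cong-≗ (λ j → trans (cong (_* lookup x j) (sumF≡sum λ k → entry 𝔽 X i k * entry 𝔽 Y k j))
                                  (*-distribʳ-sum (lookup x j) λ k → entry 𝔽 X i k * entry 𝔽 Y k j)) ⟩
    sum (λ j → sum λ k → entry 𝔽 X i k * entry 𝔽 Y k j * lookup x j)
      ≡⟨ ∑-comm (λ j k → entry 𝔽 X i k * entry 𝔽 Y k j * lookup x j) ⟩
    sum (λ k → sum λ j → entry 𝔽 X i k * entry 𝔽 Y k j * lookup x j)
      ≡⟨ sum-cong-≗ (λ k → trans (sum-cong-≗ λ j → *-assoc (entry 𝔽 X i k) (entry 𝔽 Y k j) (lookup x j))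
           (trans (sym (*-distribˡ-sum (entry 𝔽 X i k) λ j → entry 𝔽 Y k j * lookup x j))
                  (cong (entry 𝔽 X i k *_) (sym (lookup-*ᵥ Y x k))))) ⟩
    sum (λ k → entry 𝔽 X i k * lookup (Y *ᵥ x) k)
      ≡⟨ lookup-*ᵥ X (Y *ᵥ x) i ⟨
    lookup (X *ᵥ (Y *ᵥ x)) i ∎
    where open ≡-Reasoning

  sum-zero : (f : Fin n → Carrier) → (∀ i → f i ≡ 0#) → sum f ≡ 0#
  sum-zero {zero}  f e = refl
  sum-zero {suc n} f e = trans (cong₂ _+_ (e Fin.zero) (sum-zero (f ∘ Fin.suc) (e ∘ Fin.suc))) (+-identityˡ 0#)

  idM-*ᵥ : (x : V n) → idM 𝔽 *ᵥ x ≡ x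
  idM-*ᵥ x = lookup-ext _ _ λ i → trans (tabulate-*ᵥ _ x i) (pick x i)
    where
    pick : ∀ {n} (x : V n) (i : Fin n) → sum (λ j → (if does (i Fin.≟ j) then 1# else 0#) * lookup x j) ≡ lookup x i
    pick (s ∷ x) Fin.zero    = trans (cong₂ _+_ (*-identityˡ s) (sum-zero _ λ j → zeroˡ (lookup x j))) (+-identityʳ s)
    pick (s ∷ x) (Fin.suc i) = trans (cong₂ _+_ (zeroˡ s) (pick x i)) (+-identityˡ _)

  -- Conjugacy of operators and of matrices

  -- Extending by the identity on a block and passing to a pointwise equal operator become plain
  -- composition; matrix products occur only in the translation from and to `Conj`.
  record OpConj (f g : V n → V n) : Set where
    field
      to from     : V n → V n
      to-linear   : Linear to
      from-linear : Linear from
      to-from     : ∀ x → to (from x) ≡ x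
      intertwine  : ∀ x → to (f x) ≡ g (to x)

    from-to : ∀ x → from (to x) ≡ x
    from-to = leftInverse⇒rightInverse to-linear from-linear to-from

  open OpConj

  OpConj-sym : {f g : V n → V n} → OpConj f g → OpConj g f
  OpConj-sym p .to          = p .from
  OpConj-sym p .from        = p .to
  OpConj-sym p .to-linear   = p .from-linear
  OpConj-sym p .from-linear = p .to-linear
  OpConj-sym p .to-from     = from-to p
  OpConj-sym {f = f} {g} p .intertwine x = begin
    p .from (g x)                    ≡⟨ cong (p .from ∘ g) (p .to-from x) ⟨
    p .from (g (p .to (p .from x)))  ≡⟨ cong (p .from) (p .intertwine (p .from x)) ⟨
    p .from (p .to (f (p .from x)))  ≡⟨ from-to p _ ⟩
    f (p .from x)                    ∎
    where open ≡-Reasoning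

  OpConj-trans : {f g h : V n → V n} → OpConj f g → OpConj g h → OpConj f h
  OpConj-trans p q .to          = q .to ∘ p .to
  OpConj-trans p q .from        = p .from ∘ q .from
  OpConj-trans p q .to-linear   = lin-∘ (q .to-linear) (p .to-linear)
  OpConj-trans p q .from-linear = lin-∘ (p .from-linear) (q .from-linear)
  OpConj-trans p q .to-from x   = trans (cong (q .to) (p .to-from _)) (q .to-from x)
  OpConj-trans p q .intertwine x = trans (cong (q .to) (p .intertwine x)) (q .intertwine _)

  Conj⇒OpConj : {X Y : Matrix n n} → Conj 𝔽 X Y → OpConj (X *ᵥ_) (Y *ᵥ_)
  Conj⇒OpConj {X = X} {Y} (g , h , gh , gX) = record
    { to = g *ᵥ_ ; from = h *ᵥ_ ; to-linear = *ᵥ-linear g ; from-linear = *ᵥ-linear h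
    ; to-from    = λ x → trans (sym (·-*ᵥ g h x)) (trans (cong (_*ᵥ x) gh) (idM-*ᵥ x))
    ; intertwine = λ x → trans (sym (·-*ᵥ g X x)) (trans (cong (_*ᵥ x) gX) (·-*ᵥ Y g x)) }

  OpConj⇒Conj : {X Y : Matrix n n} → OpConj (X *ᵥ_) (Y *ᵥ_) → Conj 𝔽 X Y
  OpConj⇒Conj {X = X} {Y} p = g , h
    , matrix-ext _ _ (λ x → trans (·-*ᵥ g h x) (trans (g≗ (h *ᵥ x)) (trans (cong (p .to) (h≗ x))
        (trans (p .to-from x) (sym (idM-*ᵥ x))))))
    , matrix-ext _ _ (λ x → trans (·-*ᵥ g X x) (trans (g≗ (X *ᵥ x)) (trans (p .intertwine x)
        (trans (cong (Y *ᵥ_) (sym (g≗ x))) (sym (·-*ᵥ Y g x))))))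
    where
    g  = toMatrix (p .to)
    h  = toMatrix (p .from)
    g≗ = toMatrix-*ᵥ (p .to) (p .to-linear)
    h≗ = toMatrix-*ᵥ (p .from) (p .from-linear)

  Conj-sym : {X Y : Matrix n n} → Conj 𝔽 X Y → Conj 𝔽 Y X
  Conj-sym {X = X} {Y} p = OpConj⇒Conj {X = Y} {X} (OpConj-sym (Conj⇒OpConj {X = X} {Y} p))

  Conj-trans : {X Y Z : Matrix n n} → Conj 𝔽 X Y → Conj 𝔽 Y Z → Conj 𝔽 X Z
  Conj-trans {X = X} {Y} {Z} p q =
    OpConj⇒Conj {X = X} {Z} (OpConj-trans (Conj⇒OpConj {X = X} {Y} p) (Conj⇒OpConj {X = Y} {Z} q))

  -- Matrices with vanishing lower block rows

  blk-entry : Matrix a a → Matrix a m → Fin a ⊎ Fin m → Fin a ⊎ Fin m → Carrier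
  blk-entry A Z (inj₁ i) (inj₁ j) = entry 𝔽 A i j
  blk-entry A Z (inj₁ i) (inj₂ j) = entry 𝔽 Z i j
  blk-entry A Z (inj₂ i) _        = 0#

  -- `blockMat` with an arbitrary upper left block: a matrix of the nilradical has some A there,
  -- which is J_ν only after conjugation.
  blk : Matrix a a → Matrix a m → Matrix (a ℕ.+ m) (a ℕ.+ m)
  blk {a} A Z = tabulate λ i → tabulate λ j → blk-entry A Z (splitAt a i) (splitAt a j)

  -- The entry function of blockMat is local to it and cannot be named, so unification supplies this type.
  blockMat-entries : ∀ ν m (Z : Matrix (sumL ν) m) i j → _

  blockMat≡blk : ∀ ν m (Z : Matrix (sumL ν) m) → blockMat 𝔽 ν m Z ≡ blk (J 𝔽 ν) Z
  blockMat≡blk ν m Z = VecP.tabulate-cong λ i → VecP.tabulate-cong (blockMat-entries ν m Z i)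

  blockMat-entries ν m Z i j with splitAt (sumL ν) i | splitAt (sumL ν) j
  ... | inj₁ _ | inj₁ _ = refl
  ... | inj₁ _ | inj₂ _ = refl
  ... | inj₂ _ | _      = refl

  sum-splitAt : ∀ a (f : Fin (a ℕ.+ m) → Carrier) → sum f ≡ sum (λ i → f (i ↑ˡ m)) + sum (λ i → f (a ↑ʳ i))
  sum-splitAt zero    f = sym (+-identityˡ _)
  sum-splitAt (suc a) f = trans (cong (f Fin.zero +_) (sum-splitAt a (f ∘ Fin.suc))) (sym (+-assoc _ _ _))

  blk-*ᵥ : (A : Matrix a a) (Z : Matrix a m) → ∀ x y → blk A Z *ᵥ (x Vec.++ y) ≡ (A *ᵥ x +ᵥ Z *ᵥ y) Vec.++ 0ᵥ
  blk-*ᵥ {a} {m} A Z x y = lookup-ext _ _ λ i → begin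
    lookup (blk A Z *ᵥ (x Vec.++ y)) i
      ≡⟨ tabulate-*ᵥ _ (x Vec.++ y) i ⟩
    sum (λ j → blk-entry A Z (splitAt a i) (splitAt a j) * lookup (x Vec.++ y) j)
      ≡⟨ sum-splitAt a _ ⟩
    sum (λ j → blk-entry A Z (splitAt a i) (splitAt a (j ↑ˡ m)) * lookup (x Vec.++ y) (j ↑ˡ m)) +
    sum (λ j → blk-entry A Z (splitAt a i) (splitAt a (a ↑ʳ j)) * lookup (x Vec.++ y) (a ↑ʳ j))
      ≡⟨ cong₂ _+_ (sum-cong-≗ λ j → cong₂ _*_ (cong (blk-entry A Z (splitAt a i)) (FinP.splitAt-↑ˡ a j m)) (VecP.lookup-++ˡ x y j))
                   (sum-cong-≗ λ j → cong₂ _*_ (cong (blk-entry A Z (splitAt a i)) (FinP.splitAt-↑ʳ a m j)) (VecP.lookup-++ʳ x y j)) ⟩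
    sum (λ j → blk-entry A Z (splitAt a i) (inj₁ j) * lookup x j) + sum (λ j → blk-entry A Z (splitAt a i) (inj₂ j) * lookup y j)
      ≡⟨ row (splitAt a i) ⟩
    [ lookup (A *ᵥ x +ᵥ Z *ᵥ y) , lookup (0ᵥ {m}) ]′ (splitAt a i)
      ≡⟨ VecP.lookup-splitAt a (A *ᵥ x +ᵥ Z *ᵥ y) 0ᵥ i ⟨
    lookup ((A *ᵥ x +ᵥ Z *ᵥ y) Vec.++ 0ᵥ) i ∎
    where
    open ≡-Reasoning
    row : ∀ s → sum (λ j → blk-entry A Z s (inj₁ j) * lookup x j) + sum (λ j → blk-entry A Z s (inj₂ j) * lookup y j)
              ≡ [ lookup (A *ᵥ x +ᵥ Z *ᵥ y) , lookup (0ᵥ {m}) ]′ s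
    row (inj₁ i) = sym (trans (VecP.lookup-zipWith _+_ i (A *ᵥ x) (Z *ᵥ y)) (cong₂ _+_ (lookup-*ᵥ A x i) (lookup-*ᵥ Z y i)))
    row (inj₂ i) = trans (cong₂ _+_ (sum-zero _ λ j → zeroˡ (lookup x j)) (sum-zero _ λ j → zeroˡ (lookup y j)))
                         (trans (+-identityˡ 0#) (sym (VecP.lookup-replicate i 0#)))

  blk-conj : {A B : Matrix a a} (Z W : Matrix a m) (p : OpConj (A *ᵥ_) (B *ᵥ_)) → (∀ y → W *ᵥ y ≡ p .to (Z *ᵥ y)) →
             Conj 𝔽 (blk A Z) (blk B W)
  blk-conj {a} {m} {A} {B} Z W p WZ = OpConj⇒Conj (record
    { to = extend (p .to) ; from = extend (p .from)
    ; to-linear = extend-linear (p .to-linear) ; from-linear = extend-linear (p .from-linear)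
    ; to-from = λ x → trans (extend-++ (p .to) (p .from (Vec.take a x)) (Vec.drop a x))
                      (trans (cong (Vec._++ Vec.drop a x) (p .to-from _)) (VecP.take++drop≡id a x))
    ; intertwine = λ x → begin
        extend (p .to) (blk A Z *ᵥ x)
          ≡⟨ cong (λ x → extend (p .to) (blk A Z *ᵥ x)) (VecP.take++drop≡id a x) ⟨
        extend (p .to) (blk A Z *ᵥ (Vec.take a x Vec.++ Vec.drop a x))
          ≡⟨ cong (extend (p .to)) (blk-*ᵥ A Z (Vec.take a x) (Vec.drop a x)) ⟩
        extend (p .to) ((A *ᵥ Vec.take a x +ᵥ Z *ᵥ Vec.drop a x) Vec.++ 0ᵥ)
          ≡⟨ extend-++ (p .to) (A *ᵥ Vec.take a x +ᵥ Z *ᵥ Vec.drop a x) 0ᵥ ⟩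
        p .to (A *ᵥ Vec.take a x +ᵥ Z *ᵥ Vec.drop a x) Vec.++ 0ᵥ
          ≡⟨ cong (Vec._++ 0ᵥ) (trans (p .to-linear .add _ _) (cong₂ _+ᵥ_ (p .intertwine _) (sym (WZ _)))) ⟩
        (B *ᵥ p .to (Vec.take a x) +ᵥ W *ᵥ Vec.drop a x) Vec.++ 0ᵥ
          ≡⟨ blk-*ᵥ B W (p .to (Vec.take a x)) (Vec.drop a x) ⟨
        blk B W *ᵥ extend (p .to) x ∎ })
    where
    open ≡-Reasoning
    extend : (V a → V a) → V (a ℕ.+ m) → V (a ℕ.+ m)
    extend f x = f (Vec.take a x) Vec.++ Vec.drop a x
    extend-linear : ∀ {f} → Linear f → Linear (extend f)
    extend-linear lf = lin-++ (lin-∘ lf (lin-take a)) (lin-drop a)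
    extend-++ : ∀ f x y → extend f (x Vec.++ y) ≡ f x Vec.++ y
    extend-++ f x y = cong₂ Vec._++_ (cong f (take-++ x y)) (drop-++ x y)

  -- The Jordan operator and the dimensions of the kernels of its powers

  pow : {A : Set} → (A → A) → ℕ → A → A
  pow f zero    x = x
  pow f (suc k) x = pow f k (f x)

  pow-comm : {A : Set} (f : A → A) → ∀ k x → pow f k (f x) ≡ f (pow f k x)
  pow-comm f zero    x = refl
  pow-comm f (suc k) x = pow-comm f k (f x)

  pow-+ : {A : Set} (f : A → A) → ∀ j k x → pow f (j ℕ.+ k) x ≡ pow f j (pow f k x)
  pow-+ f zero    k x = refl
  pow-+ f (suc j) k x = trans (pow-+ f j k (f x)) (cong (pow f j) (pow-comm f k x))

  pow-zero : {f : V n → V n} → Linear f → ∀ k → pow f k 0ᵥ ≡ 0ᵥ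
  pow-zero lf zero    = refl
  pow-zero {f = f} lf (suc k) = trans (cong (pow f k) (zero-map lf)) (pow-zero lf k)

  pow-linear : {f : V n → V n} → Linear f → ∀ k → Linear (pow f k)
  pow-linear lf zero    = lin-id
  pow-linear lf (suc k) = lin-∘ (pow-linear lf k) lf

  shift : V n → V n
  shift []       = []
  shift (s ∷ x) = x ∷ʳ 0#

  -- Multiplication by J_ν: within each block every coordinate moves one place to the front. The
  -- recursion over blocks makes the kernels of powers computable; `jordan-*ᵥ` ties it to the
  -- matrix.
  Jop : ∀ ν → V (sumL ν) → V (sumL ν)
  Jop []      x = x
  Jop (a ∷ ν) x = shift (Vec.take a x) Vec.++ Jop ν (Vec.drop a x)

  -- Reading past the end gives 0, the same 0 that `shift` brings in, so shifting becomes an index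
  -- shift without boundary case.
  at : V n → ℕ → Carrier
  at []      i       = 0#
  at (s ∷ x) zero    = s
  at (s ∷ x) (suc i) = at x i

  lookup≡at : (x : V n) (i : Fin n) → lookup x i ≡ at x (toℕ i)
  lookup≡at (s ∷ x) Fin.zero    = refl
  lookup≡at (s ∷ x) (Fin.suc i) = lookup≡at x i

  at-∷ʳ : (x : V n) → ∀ i → at (x ∷ʳ 0#) i ≡ at x i
  at-∷ʳ []      zero    = refl
  at-∷ʳ []      (suc i) = refl
  at-∷ʳ (s ∷ x) zero    = refl
  at-∷ʳ (s ∷ x) (suc i) = at-∷ʳ x i

  at-shift : (x : V n) → ∀ i → at (shift x) i ≡ at x (suc i)
  at-shift []      i = refl
  at-shift (s ∷ x) i = at-∷ʳ x i

  at-overflow : (x : V n) → ∀ {i} → n ≤ i → at x i ≡ 0#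
  at-overflow []      _         = refl
  at-overflow (s ∷ x) (s≤s n≤i) = at-overflow x n≤i

  at-++ : (x : V a) (y : V b) → ∀ i → at (x Vec.++ y) i ≡ (if i ℕ.<ᵇ a then at x i else at y (i ℕ.∸ a))
  at-++ []      y i       = refl
  at-++ (s ∷ x) y zero    = refl
  at-++ (s ∷ x) y (suc i) = at-++ x y i

  at-Jop : ∀ ν (x : V (sumL ν)) i → at (Jop ν x) i ≡ (if superOne ν i then at x (suc i) else 0#)
  at-Jop []      [] i = refl
  at-Jop (a ∷ ν) x  i
    rewrite at-++ (shift (Vec.take a x)) (Jop ν (Vec.drop a x)) i
          | at-shift (Vec.take a x) i
          | at-Jop ν (Vec.drop a x) (i ℕ.∸ a)
          | sym (cong (λ x → at x (suc i)) (VecP.take++drop≡id a x))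
          | at-++ (Vec.take a x) (Vec.drop a x) (suc i)
    with i ℕ.<ᵇ a in p | suc i ℕ.<ᵇ a in q
  ... | true  | true  = refl
  -- The last row of the first block: `superOne` is false there, and the position past the block
  -- reads as 0.
  ... | true  | false = at-overflow (Vec.take a x) (ℕP.≮⇒≥ λ lt → subst T q (ℕP.<⇒<ᵇ lt))
  ... | false | true  = ⊥-elim (subst T p (ℕP.<⇒<ᵇ (ℕP.<-trans (ℕP.n<1+n i) (ℕP.<ᵇ⇒< (suc i) a (subst T (sym q) _)))))
  ... | false | false = cong (λ j → if superOne ν (i ℕ.∸ a) then at (Vec.drop a x) j else 0#)
                             (sym (ℕP.+-∸-assoc 1 {i} {a} (ℕP.≮⇒≥ λ lt → subst T p (ℕP.<⇒<ᵇ lt))))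

  sum-delta : (x : V n) → ∀ t b →
    sum (λ j → (if does (toℕ j ℕ.≟ t) ∧ b then 1# else 0#) * lookup x j) ≡ (if b then at x t else 0#)
  sum-delta []      t       false = refl
  sum-delta []      t       true  = refl
  sum-delta (s ∷ x) zero    false = trans (cong₂ _+_ (zeroˡ s) (sum-zero _ λ j → zeroˡ (lookup x j))) (+-identityʳ 0#)
  sum-delta (s ∷ x) zero    true  = trans (cong₂ _+_ (*-identityˡ s) (sum-zero _ λ j → zeroˡ (lookup x j))) (+-identityʳ s)
  sum-delta (s ∷ x) (suc t) b     = trans (cong₂ _+_ (zeroˡ s) (sum-delta x t b)) (+-identityˡ _)

  jordan-*ᵥ : ∀ ν x → jordan 𝔽 ν (sumL ν) *ᵥ x ≡ Jop ν x
  jordan-*ᵥ ν x = lookup-ext _ _ λ i →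
    trans (tabulate-*ᵥ _ x i)
    (trans (sum-delta x (suc (toℕ i)) (superOne ν (toℕ i)))
    (trans (sym (at-Jop ν x (toℕ i))) (sym (lookup≡at (Jop ν x) i))))

  -- Vectors supported on the first `k` coordinates, that is, the kernel of the `k`-th power of
  -- `shift`.
  Low : ℕ → V n → Set
  Low zero    x       = x ≡ 0ᵥ
  Low (suc k) []      = ⊤
  Low (suc k) (_ ∷ x) = Low k x

  low-∷ʳ⁺ : ∀ k (x : V n) → Low k x → Low k (x ∷ʳ 0#)
  low-∷ʳ⁺ zero    []      l = refl
  low-∷ʳ⁺ zero    (s ∷ x) l = cong₂ _∷_ (cong head l) (low-∷ʳ⁺ zero x (cong tail l))
  low-∷ʳ⁺ (suc zero)    []      l = refl
  low-∷ʳ⁺ (suc (suc k)) []      l = _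
  low-∷ʳ⁺ (suc k) (s ∷ x) l = low-∷ʳ⁺ k x l

  low-∷ʳ⁻ : ∀ k (x : V n) → Low k (x ∷ʳ 0#) → Low k x
  low-∷ʳ⁻ zero    []      l = refl
  low-∷ʳ⁻ zero    (s ∷ x) l = cong₂ _∷_ (cong head l) (low-∷ʳ⁻ zero x (cong tail l))
  low-∷ʳ⁻ (suc k) []      l = _
  low-∷ʳ⁻ (suc k) (s ∷ x) l = low-∷ʳ⁻ k x l

  low-shift⁺ : ∀ k (x : V n) → Low (suc k) x → Low k (shift x)
  low-shift⁺ zero    []      l = refl
  low-shift⁺ (suc k) []      l = _
  low-shift⁺ k       (s ∷ x) l = low-∷ʳ⁺ k x l

  low-shift⁻ : ∀ k (x : V n) → Low k (shift x) → Low (suc k) x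
  low-shift⁻ k []      l = _
  low-shift⁻ k (s ∷ x) l = low-∷ʳ⁻ k x l

  AllLow : ℕ → ∀ ν → V (sumL ν) → Set
  AllLow k []      x = ⊤
  AllLow k (a ∷ ν) x = Low k (Vec.take a x) × AllLow k ν (Vec.drop a x)

  take-drop-zero : ∀ a (x : V (a ℕ.+ b)) → Vec.take a x ≡ 0ᵥ → Vec.drop a x ≡ 0ᵥ → x ≡ 0ᵥ
  take-drop-zero a x p q = trans (sym (VecP.take++drop≡id a x)) (trans (cong₂ Vec._++_ p q) (++-zero a))

  allLow⇒kernel : ∀ k ν x → AllLow k ν x → pow (Jop ν) k x ≡ 0ᵥ
  allLow⇒kernel zero    []      []  l       = refl
  allLow⇒kernel zero    (a ∷ ν) x   (p , l) = take-drop-zero a x p (allLow⇒kernel zero ν (Vec.drop a x) l)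
  allLow⇒kernel (suc k) ν       x   l       = allLow⇒kernel k ν (Jop ν x) (step ν x l)
    where
    step : ∀ ν x → AllLow (suc k) ν x → AllLow k ν (Jop ν x)
    step []      x l       = _
    step (a ∷ ν) x (p , l) =
      subst (Low k) (sym (take-++ (shift (Vec.take a x)) _)) (low-shift⁺ k (Vec.take a x) p) ,
      subst (AllLow k ν) (sym (drop-++ (shift (Vec.take a x)) _)) (step ν (Vec.drop a x) l)

  kernel⇒allLow : ∀ k ν x → pow (Jop ν) k x ≡ 0ᵥ → AllLow k ν x
  kernel⇒allLow zero    []      x e = _
  kernel⇒allLow zero    (a ∷ ν) x e = trans (cong (Vec.take a) e) (zero-map (lin-take a)) ,
                                      kernel⇒allLow zero ν _ (trans (cong (Vec.drop a) e) (zero-map (lin-drop a)))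
  kernel⇒allLow (suc k) ν       x e = step ν x (kernel⇒allLow k ν (Jop ν x) e)
    where
    step : ∀ ν x → AllLow k ν (Jop ν x) → AllLow (suc k) ν x
    step []      x l       = _
    step (a ∷ ν) x (p , l) =
      low-shift⁻ k (Vec.take a x) (subst (Low k) (take-++ (shift (Vec.take a x)) _) p) ,
      step ν (Vec.drop a x) (subst (AllLow k ν) (drop-++ (shift (Vec.take a x)) _) l)

  -- `pad` parametrises the vectors supported on the first `k` coordinates and `truncate` reads the
  -- parameter off: one bounds their dimension from below by `k ⊓ n`, the other from above.
  pad : ∀ k n → V (k ℕ.⊓ n) → V n
  pad zero    n       x       = 0ᵥ
  pad (suc k) zero    x       = []
  pad (suc k) (suc n) (s ∷ x) = s ∷ pad k n x

  truncate : ∀ k n → V n → V (k ℕ.⊓ n)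
  truncate zero    n       x       = []
  truncate (suc k) zero    x       = []
  truncate (suc k) (suc n) (s ∷ x) = s ∷ truncate k n x

  pad-linear : ∀ k n → Linear (pad k n)
  pad-linear zero    n       = lin-0
  pad-linear (suc k) zero    = lin-0
  pad-linear (suc k) (suc n) .add   (s ∷ x) (t ∷ y) = cong (s + t ∷_) (pad-linear k n .add x y)
  pad-linear (suc k) (suc n) .scale c (s ∷ x)       = cong (c * s ∷_) (pad-linear k n .scale c x)

  truncate-linear : ∀ k n → Linear (truncate k n)
  truncate-linear zero    n       = lin-0
  truncate-linear (suc k) zero    = lin-0
  truncate-linear (suc k) (suc n) .add   (s ∷ x) (t ∷ y) = cong (s + t ∷_) (truncate-linear k n .add x y)
  truncate-linear (suc k) (suc n) .scale c (s ∷ x)       = cong (c * s ∷_) (truncate-linear k n .scale c x)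

  pad-injective : ∀ k n → Injective₀ (pad k n)
  pad-injective zero    n       []      e = refl
  pad-injective (suc k) zero    []      e = refl
  pad-injective (suc k) (suc n) (s ∷ x) e = cong₂ _∷_ (cong head e) (pad-injective k n x (cong tail e))

  pad-low : ∀ k n x → Low k (pad k n x)
  pad-low zero    n       x       = refl
  pad-low (suc k) zero    x       = _
  pad-low (suc k) (suc n) (s ∷ x) = pad-low k n x

  truncate-injective : ∀ k n x → Low k x → truncate k n x ≡ 0ᵥ → x ≡ 0ᵥ
  truncate-injective zero    n       x       l e = l
  truncate-injective (suc k) zero    []      l e = refl
  truncate-injective (suc k) (suc n) (s ∷ x) l e = cong₂ _∷_ (cong head e) (truncate-injective k n x l (cong tail e))

  padAll : ∀ k ν → V (capSum k ν) → V (sumL ν)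
  padAll k []      x = x
  padAll k (a ∷ ν) x = pad k a (Vec.take (k ℕ.⊓ a) x) Vec.++ padAll k ν (Vec.drop (k ℕ.⊓ a) x)

  truncateAll : ∀ k ν → V (sumL ν) → V (capSum k ν)
  truncateAll k []      x = x
  truncateAll k (a ∷ ν) x = truncate k a (Vec.take a x) Vec.++ truncateAll k ν (Vec.drop a x)

  padAll-linear : ∀ k ν → Linear (padAll k ν)
  padAll-linear k []      = lin-id
  padAll-linear k (a ∷ ν) = lin-++ (lin-∘ (pad-linear k a) (lin-take (k ℕ.⊓ a))) (lin-∘ (padAll-linear k ν) (lin-drop (k ℕ.⊓ a)))

  truncateAll-linear : ∀ k ν → Linear (truncateAll k ν)
  truncateAll-linear k []      = lin-id
  truncateAll-linear k (a ∷ ν) = lin-++ (lin-∘ (truncate-linear k a) (lin-take a)) (lin-∘ (truncateAll-linear k ν) (lin-drop a))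

  ++-zero⁻ˡ : (x : V a) (y : V b) → x Vec.++ y ≡ 0ᵥ → x ≡ 0ᵥ
  ++-zero⁻ˡ {a} x y e = VecP.++-injectiveˡ x 0ᵥ (trans e (sym (++-zero a)))

  ++-zero⁻ʳ : (x : V a) (y : V b) → x Vec.++ y ≡ 0ᵥ → y ≡ 0ᵥ
  ++-zero⁻ʳ {a} x y e = VecP.++-injectiveʳ x 0ᵥ (trans e (sym (++-zero a)))

  padAll-injective : ∀ k ν → Injective₀ (padAll k ν)
  padAll-injective k []      x e = e
  padAll-injective k (a ∷ ν) x e = take-drop-zero (k ℕ.⊓ a) x
    (pad-injective k a _ (++-zero⁻ˡ (pad k a _) _ e)) (padAll-injective k ν _ (++-zero⁻ʳ (pad k a (Vec.take (k ℕ.⊓ a) x)) _ e))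

  padAll-allLow : ∀ k ν x → AllLow k ν (padAll k ν x)
  padAll-allLow k []      x = _
  padAll-allLow k (a ∷ ν) x =
    subst (Low k) (sym (take-++ (pad k a (Vec.take (k ℕ.⊓ a) x)) _)) (pad-low k a _) ,
    subst (AllLow k ν) (sym (drop-++ (pad k a (Vec.take (k ℕ.⊓ a) x)) _)) (padAll-allLow k ν _)

  truncateAll-injective : ∀ k ν x → AllLow k ν x → truncateAll k ν x ≡ 0ᵥ → x ≡ 0ᵥ
  truncateAll-injective k []      x l       e = e
  truncateAll-injective k (a ∷ ν) x (p , l) e = take-drop-zero a x
    (truncate-injective k a _ p (++-zero⁻ˡ (truncate k a (Vec.take a x)) _ e))
    (truncateAll-injective k ν _ l (++-zero⁻ʳ (truncate k a (Vec.take a x)) _ e))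

  -- The kernel of f^k has dimension at least d.
  record KernelDim (f : V n → V n) (k d : ℕ) : Set where
    field
      embed           : V d → V n
      embed-linear    : Linear embed
      embed-injective : Injective₀ embed
      embed-kernel    : ∀ x → pow f k (embed x) ≡ 0ᵥ

  open KernelDim

  kernelDim-Jop : ∀ k ν → KernelDim (Jop ν) k (capSum k ν)
  kernelDim-Jop k ν = record
    { embed = padAll k ν ; embed-linear = padAll-linear k ν ; embed-injective = padAll-injective k ν
    ; embed-kernel = λ x → allLow⇒kernel k ν (padAll k ν x) (padAll-allLow k ν x) }

  -- Cutting every block to its first `k` coordinates is injective on the kernel of the `k`-th
  -- power, so the bound in `kernelDim-Jop` is sharp.
  kernelDim-Jop-≤ : ∀ ν → KernelDim (Jop ν) k d → d ≤ capSum k ν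
  kernelDim-Jop-≤ {k} ν D = injective⇒≤ (truncateAll k ν ∘ D .embed) (lin-∘ (truncateAll-linear k ν) (D .embed-linear))
    λ x e → D .embed-injective x (truncateAll-injective k ν (D .embed x) (kernel⇒allLow k ν _ (D .embed-kernel x)) e)

  pow-intertwine : {f g : V n → V n} (p : OpConj f g) → ∀ k x → pow g k (p .to x) ≡ p .to (pow f k x)
  pow-intertwine p zero x = refl
  pow-intertwine {g = g} p (suc k) x = trans (cong (pow g k) (sym (p .intertwine x))) (pow-intertwine p k _)

  kernelDim-conj : {f g : V n → V n} → OpConj f g → KernelDim f k d → KernelDim g k d
  kernelDim-conj p D .embed             = p .to ∘ D .embed
  kernelDim-conj p D .embed-linear      = lin-∘ (p .to-linear) (D .embed-linear)
  kernelDim-conj p D .embed-injective x = D .embed-injective x ∘ leftInverse⇒injective (p .from-linear) (from-to p) _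
  kernelDim-conj {k = k} p D .embed-kernel x =
    trans (pow-intertwine p k _) (trans (cong (p .to) (D .embed-kernel x)) (zero-map (p .to-linear)))

  opConj-≗ : {f g : V n → V n} → (∀ x → f x ≡ g x) → OpConj f g
  opConj-≗ e = record { to = id ; from = id ; to-linear = lin-id ; from-linear = lin-id ; to-from = λ _ → refl ; intertwine = e }

  inClass⇒opConj : ∀ ν (X : Matrix (sumL ν) (sumL ν)) → InClass 𝔽 ν X → OpConj (X *ᵥ_) (Jop ν)
  inClass⇒opConj ν X (_ , c) = OpConj-trans (Conj⇒OpConj {X = X} c) (opConj-≗ (jordan-*ᵥ ν))

  opConj⇒inClass : ∀ ν (X : Matrix (sumL ν) (sumL ν)) → OpConj (X *ᵥ_) (Jop ν) → InClass 𝔽 ν X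
  opConj⇒inClass ν X p = refl , OpConj⇒Conj {X = X} (OpConj-trans p (OpConj-sym (opConj-≗ (jordan-*ᵥ ν))))

  inClass⇒kernelDim : ∀ k ν (X : Matrix n n) → InClass 𝔽 ν X → KernelDim (X *ᵥ_) k (capSum k ν)
  inClass⇒kernelDim k ν X c@(refl , _) = kernelDim-conj (OpConj-sym (inClass⇒opConj ν X c)) (kernelDim-Jop k ν)

  inClass⇒kernelDim-≤ : ∀ ν (X : Matrix n n) → InClass 𝔽 ν X → KernelDim (X *ᵥ_) k d → d ≤ capSum k ν
  inClass⇒kernelDim-≤ ν X c@(refl , _) D = kernelDim-Jop-≤ ν (kernelDim-conj (inClass⇒opConj ν X c) D)

  inClass⇒capSum≡ : ∀ ν ν′ (X : Matrix n n) → InClass 𝔽 ν X → InClass 𝔽 ν′ X → ∀ k → capSum k ν ≡ capSum k ν′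
  inClass⇒capSum≡ ν ν′ X c c′ k = ℕP.≤-antisym (inClass⇒kernelDim-≤ ν′ X c′ (inClass⇒kernelDim k ν X c))
                                               (inClass⇒kernelDim-≤ ν X c (inClass⇒kernelDim k ν′ X c′))

  -- Jordan bases of nilpotent operators

  -- Preimages chosen for the basis vectors extend linearly. The target map `g` is general, although
  -- the identity is the case of interest, so that the recursion can drop a basis vector.
  section : (e : V a → V n) (g : V m → V n) → Linear e → Linear g → (∀ y → ∃ λ x → e x ≡ g y) →
            Σ (V m → V a) λ s → Linear s × (∀ y → e (s y) ≡ g y)
  section {m = zero}  e g le lg lift = (λ _ → 0ᵥ) , lin-0 , λ { [] → trans (zero-map le) (sym (zero-map lg)) }
  section {m = suc m} e g le lg lift
    with x , ex ← lift (1# ∷ 0ᵥ)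
       | s , ls , es ← section e (g ∘ (0# ∷_)) le (lin-∘ lg lin-0∷) (λ y → lift (0# ∷ y))
    = (λ y → head y ∙ᵥ x +ᵥ s (tail y))
    , lin-+ (lin-head-∙ x) (lin-∘ ls lin-tail)
    , λ { (t ∷ y) → trans (le .add _ _) (trans (cong₂ _+ᵥ_ (trans (le .scale t x) (cong (t ∙ᵥ_) ex)) (es y)) (sym (∷-split lg t y))) }

  -- The partition condition makes `sumL ν` equal to `n`, so the one-sided inverse `s` already makes
  -- `e` an isomorphism. The two sizes are kept apart because they agree only propositionally.
  JordanBasis : ∀ n → (V n → V n) → Set
  JordanBasis n f = ∃ λ ν → IsPartition ν n × Σ (V (sumL ν) → V n) λ e → Σ (V n → V (sumL ν)) λ s →
    Linear e × Linear s × (∀ x → e (s x) ≡ x) × (∀ y → e (Jop ν y) ≡ f (e y))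

  module Chains {n : ℕ} (f : V n → V n) (lf : Linear f) where

    -- A pair (v , ℓ) stands for v, f v, ..., f^(ℓ-1) v, with f^ℓ v = 0 expressed by `Killed`.
    -- Independence is not built in; it results from the final comparison of total length with `n`.
    Chain : Set
    Chain = V n × ℕ

    lengths : List Chain → List ℕ
    lengths = List.map proj₂

    total : List Chain → ℕ
    total L = sumL (lengths L)

    Killed : List Chain → Set
    Killed L = ∀ {v ℓ} → (v , ℓ) ∈ L → pow f ℓ v ≡ 0ᵥ

    -- Generation modulo the image of f: by Nakayama this is all that is needed when f is nilpotent.
    data Gen (L : List Chain) : V n → Set where
      top   : ∀ {v ℓ} → (v , ℓ) ∈ L → Gen L v
      img   : ∀ u → Gen L (f u)
      _⊹_   : ∀ {u v} → Gen L u → Gen L v → Gen L (u +ᵥ v)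
      _⊛_   : ∀ k {v} → Gen L v → Gen L (k ∙ᵥ v)

    Generating : List Chain → Set
    Generating L = ∀ v → Gen L v

    gen-zero : ∀ {L} → Gen L 0ᵥ
    gen-zero = subst (Gen _) (zero-map lf) (img 0ᵥ)

    gen-mono : ∀ {L L′} → (∀ {v ℓ} → (v , ℓ) ∈ L → Gen L′ v) → ∀ {v} → Gen L v → Gen L′ v
    gen-mono h (top p) = h p
    gen-mono h (img u) = img u
    gen-mono h (p ⊹ q) = gen-mono h p ⊹ gen-mono h q
    gen-mono h (k ⊛ p) = k ⊛ gen-mono h p

    gen-pow : ∀ {L} k {v} → Gen L v → Gen L (pow f k v)
    gen-pow zero    p = p
    gen-pow (suc k) p = subst (Gen _) (sym (pow-comm f k _)) (img _)

    -- The highest power of `f` comes first and the top `v` last, as in a Jordan block with ones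
    -- above the diagonal, so that `shift` on coordinates acts as `f`.
    chain : V n → V ℓ → V n
    chain         v []      = 0ᵥ
    chain {suc ℓ} v (s ∷ x) = s ∙ᵥ pow f ℓ v +ᵥ chain v x

    chain-linear : ∀ v → Linear (chain {ℓ} v)
    chain-linear {zero}  v .add   []      []      = sym (+ᵥ-identityˡ 0ᵥ)
    chain-linear {suc ℓ} v .add   (s ∷ x) (t ∷ y) =
      trans (cong₂ _+ᵥ_ (+-∙ s t _) (chain-linear v .add x y)) (+ᵥ-interchange _ _ _ _)
    chain-linear {zero}  v .scale k []            = sym (∙0 k)
    chain-linear {suc ℓ} v .scale k (s ∷ x)       =
      trans (cong₂ _+ᵥ_ (sym (∙∙ k s _)) (chain-linear v .scale k x)) (sym (∙-distrib k _ _))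

    chain-∷ʳ : ∀ v (x : V ℓ) → chain v (x ∷ʳ 0#) ≡ f (chain v x)
    chain-∷ʳ         v []      = trans (+ᵥ-identityʳ _) (trans (0∙ v) (sym (zero-map lf)))
    chain-∷ʳ {suc ℓ} v (s ∷ x) = begin
      s ∙ᵥ pow f ℓ (f v) +ᵥ chain v (x ∷ʳ 0#)     ≡⟨ cong₂ (λ p q → s ∙ᵥ p +ᵥ q) (pow-comm f ℓ v) (chain-∷ʳ v x) ⟩
      s ∙ᵥ f (pow f ℓ v) +ᵥ f (chain v x)         ≡⟨ cong (_+ᵥ f (chain v x)) (lf .scale s _) ⟨
      f (s ∙ᵥ pow f ℓ v) +ᵥ f (chain v x)         ≡⟨ lf .add _ _ ⟨
      f (s ∙ᵥ pow f ℓ v +ᵥ chain v x)             ∎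
      where open ≡-Reasoning

    -- The coefficient that `shift` discards belongs to the end of the chain, which `f` sends to 0.
    chain-shift : ∀ v (x : V ℓ) → pow f ℓ v ≡ 0ᵥ → chain v (shift x) ≡ f (chain v x)
    chain-shift v []      e = sym (zero-map lf)
    chain-shift {suc ℓ} v (s ∷ x) e = trans (chain-∷ʳ v x) (sym (begin
      f (s ∙ᵥ pow f ℓ v +ᵥ chain v x)             ≡⟨ lf .add _ _ ⟩
      f (s ∙ᵥ pow f ℓ v) +ᵥ f (chain v x)         ≡⟨ cong (_+ᵥ f (chain v x)) (lf .scale s _) ⟩
      s ∙ᵥ f (pow f ℓ v) +ᵥ f (chain v x)         ≡⟨ cong (λ p → s ∙ᵥ p +ᵥ f (chain v x)) (trans (sym (pow-comm f ℓ v)) e) ⟩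
      s ∙ᵥ 0ᵥ +ᵥ f (chain v x)                    ≡⟨ trans (cong (_+ᵥ f (chain v x)) (∙0 s)) (+ᵥ-identityˡ _) ⟩
      f (chain v x)                               ∎))
      where open ≡-Reasoning

    chain-last : ∀ ℓ v → chain v (0ᵥ {ℓ} ∷ʳ 1#) ≡ v
    chain-last zero    v = trans (+ᵥ-identityʳ _) (1∙ v)
    chain-last (suc ℓ) v = trans (cong₂ _+ᵥ_ (0∙ _) (chain-last ℓ v)) (+ᵥ-identityˡ v)

    eval : ∀ L → V (total L) → V n
    eval []            x = 0ᵥ
    eval ((v , ℓ) ∷ L) x = chain v (Vec.take ℓ x) +ᵥ eval L (Vec.drop ℓ x)

    eval-linear : ∀ L → Linear (eval L)
    eval-linear []            = lin-0
    eval-linear ((v , ℓ) ∷ L) = lin-+ (lin-∘ (chain-linear v) (lin-take ℓ)) (lin-∘ (eval-linear L) (lin-drop ℓ))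

    eval-++ : ∀ v L (x : V ℓ) y → eval ((v , ℓ) ∷ L) (x Vec.++ y) ≡ chain v x +ᵥ eval L y
    eval-++ v L x y = cong₂ (λ x y → chain v x +ᵥ eval L y) (take-++ x y) (drop-++ x y)

    eval-Jop : ∀ L → Killed L → ∀ x → eval L (Jop (lengths L) x) ≡ f (eval L x)
    eval-Jop []            κ x = sym (zero-map lf)
    eval-Jop ((v , ℓ) ∷ L) κ x =
      trans (eval-++ v L (shift (Vec.take ℓ x)) _)
      (trans (cong₂ _+ᵥ_ (chain-shift v (Vec.take ℓ x) (κ (here refl))) (eval-Jop L (κ ∘ there) (Vec.drop ℓ x)))
             (sym (lf .add _ _)))

    eval-top : ∀ L → Killed L → ∀ {v ℓ} → (v , ℓ) ∈ L → ∃ λ x → eval L x ≡ v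
    -- A chain of length 0 offers no coordinate, but `Killed` says that its top is 0.
    eval-top ((v , zero) ∷ L)  κ (here refl) = 0ᵥ , trans (zero-map (eval-linear ((v , zero) ∷ L))) (sym (κ (here refl)))
    eval-top ((v , suc ℓ) ∷ L) κ (here refl) = (0ᵥ {ℓ} ∷ʳ 1#) Vec.++ 0ᵥ ,
      trans (eval-++ v L (0ᵥ {ℓ} ∷ʳ 1#) 0ᵥ)
      (trans (cong₂ _+ᵥ_ (chain-last ℓ v) (zero-map (eval-linear L))) (+ᵥ-identityʳ v))
    eval-top ((u , ℓ) ∷ L)     κ (there p) with x , e ← eval-top L (κ ∘ there) p = 0ᵥ {ℓ} Vec.++ x ,
      trans (eval-++ u L (0ᵥ {ℓ}) x)
      (trans (cong₂ _+ᵥ_ (zero-map (chain-linear {ℓ} u)) e) (+ᵥ-identityˡ _))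

    gen-split : ∀ L → Killed L → ∀ {v} → Gen L v → ∃ λ x → ∃ λ u → v ≡ eval L x +ᵥ f u
    gen-split L κ (top p) with x , e ← eval-top L κ p =
      x , 0ᵥ , sym (trans (cong (eval L x +ᵥ_) (zero-map lf)) (trans (+ᵥ-identityʳ _) e))
    gen-split L κ (img u) = 0ᵥ , u , sym (trans (cong (_+ᵥ f u) (zero-map (eval-linear L))) (+ᵥ-identityˡ _))
    gen-split L κ (p ⊹ q) with x , u , refl ← gen-split L κ p | y , w , refl ← gen-split L κ q =
      x +ᵥ y , u +ᵥ w , trans (+ᵥ-interchange _ _ _ _) (sym (cong₂ _+ᵥ_ (eval-linear L .add x y) (lf .add u w)))
    gen-split L κ (k ⊛ p) with x , u , refl ← gen-split L κ p =
      k ∙ᵥ x , k ∙ᵥ u , trans (∙-distrib k _ _) (sym (cong₂ _+ᵥ_ (eval-linear L .scale k x) (lf .scale k u)))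

    -- Nakayama by iteration: the remainder `u` is itself an evaluated vector plus some `f w`, which
    -- pushes the error one power of `f` further. Once `pow f k` is zero, `eval L` is onto.
    eval-onto-mod : ∀ L → Killed L → Generating L → ∀ k v → ∃ λ x → ∃ λ u → v ≡ eval L x +ᵥ pow f k u
    eval-onto-mod L κ gen zero v = 0ᵥ , v , sym (trans (cong (_+ᵥ v) (zero-map (eval-linear L))) (+ᵥ-identityˡ v))
    eval-onto-mod L κ gen (suc k) v
      with x , u , refl ← eval-onto-mod L κ gen k v
      with y , w , refl ← gen-split L κ (gen u)
      = x +ᵥ pow (Jop (lengths L)) k y , w , (begin
        eval L x +ᵥ pow f k (eval L y +ᵥ f w)                 ≡⟨ cong (eval L x +ᵥ_) (pow-linear lf k .add _ _) ⟩
        eval L x +ᵥ (pow f k (eval L y) +ᵥ pow f k (f w))     ≡⟨ +ᵥ-assoc _ _ _ ⟨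
        (eval L x +ᵥ pow f k (eval L y)) +ᵥ pow f k (f w)     ≡⟨ cong (λ p → (eval L x +ᵥ p) +ᵥ pow f k (f w)) (eval-pow k y) ⟨
        (eval L x +ᵥ eval L (pow (Jop (lengths L)) k y)) +ᵥ pow f k (f w)
                                                              ≡⟨ cong (_+ᵥ pow f k (f w)) (eval-linear L .add _ _) ⟨
        eval L (x +ᵥ pow (Jop (lengths L)) k y) +ᵥ pow f k (f w) ∎)
      where
      open ≡-Reasoning
      eval-pow : ∀ k y → eval L (pow (Jop (lengths L)) k y) ≡ pow f k (eval L y)
      eval-pow zero    y = refl
      eval-pow (suc k) y = trans (eval-pow k _) (cong (pow f k) (eval-Jop L κ y))

    ChainFactor : V n → V ℓ → Set
    ChainFactor {ℓ} v x = ∃ λ j → ∃ λ d → ∃ λ u → j < ℓ × ¬ d ≡ 0# × chain v x ≡ pow f j (d ∙ᵥ v +ᵥ f u)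

    -- `j` is the lowest power of `f` with a nonzero coefficient, and `d` is that coefficient; every
    -- higher power keeps at least one `f` after `pow f j` is taken out, which gives the term `f u`.
    chain-factor : ∀ v (x : V ℓ) → x ≡ 0ᵥ ⊎ ChainFactor v x
    chain-factor v []      = inj₁ refl
    chain-factor {suc ℓ} v (s ∷ x) with chain-factor v x
    ... | inj₂ (j , d , u , j<ℓ , d≢0 , e) with o , refl ← ℕP.m≤n⇒∃[o]m+o≡n j<ℓ =
      inj₂ (j , d , u +ᵥ s ∙ᵥ pow f o v , ℕP.m≤n⇒m≤1+n j<ℓ , d≢0 , (begin
        s ∙ᵥ pow f (suc (j ℕ.+ o)) v +ᵥ chain v x
          ≡⟨ cong₂ (λ i p → s ∙ᵥ pow f i v +ᵥ p) (sym (ℕP.+-suc j o)) e ⟩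
        s ∙ᵥ pow f (j ℕ.+ suc o) v +ᵥ pow f j (d ∙ᵥ v +ᵥ f u)
          ≡⟨ cong (_+ᵥ pow f j (d ∙ᵥ v +ᵥ f u)) (trans (cong (s ∙ᵥ_) (pow-+ f j (suc o) v)) (sym (pow-linear lf j .scale s _))) ⟩
        pow f j (s ∙ᵥ pow f (suc o) v) +ᵥ pow f j (d ∙ᵥ v +ᵥ f u)
          ≡⟨ trans (+ᵥ-comm _ _) (sym (pow-linear lf j .add _ _)) ⟩
        pow f j ((d ∙ᵥ v +ᵥ f u) +ᵥ s ∙ᵥ pow f (suc o) v)
          ≡⟨ cong (pow f j) (+ᵥ-assoc _ _ _) ⟩
        pow f j (d ∙ᵥ v +ᵥ (f u +ᵥ s ∙ᵥ pow f (suc o) v))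
          ≡⟨ cong (λ p → pow f j (d ∙ᵥ v +ᵥ (f u +ᵥ p))) (trans (cong (s ∙ᵥ_) (pow-comm f o v)) (sym (lf .scale s _))) ⟩
        pow f j (d ∙ᵥ v +ᵥ (f u +ᵥ f (s ∙ᵥ pow f o v)))
          ≡⟨ cong (λ p → pow f j (d ∙ᵥ v +ᵥ p)) (lf .add _ _) ⟨
        pow f j (d ∙ᵥ v +ᵥ f (u +ᵥ s ∙ᵥ pow f o v)) ∎))
      where open ≡-Reasoning
    ... | inj₁ refl with s ≟ 0#
    ...   | yes refl = inj₁ refl
    ...   | no s≢0   = inj₂ (ℓ , s , 0ᵥ , ℕP.≤-refl , s≢0 , (begin
      s ∙ᵥ pow f ℓ v +ᵥ chain v (0ᵥ {ℓ})    ≡⟨ cong (s ∙ᵥ pow f ℓ v +ᵥ_) (zero-map (chain-linear {ℓ} v)) ⟩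
      s ∙ᵥ pow f ℓ v +ᵥ 0ᵥ                  ≡⟨ +ᵥ-identityʳ _ ⟩
      s ∙ᵥ pow f ℓ v                        ≡⟨ pow-linear lf ℓ .scale s v ⟨
      pow f ℓ (s ∙ᵥ v)                      ≡⟨ cong (pow f ℓ) (trans (cong (s ∙ᵥ v +ᵥ_) (zero-map lf)) (+ᵥ-identityʳ _)) ⟨
      pow f ℓ (s ∙ᵥ v +ᵥ f 0ᵥ)              ∎))
      where open ≡-Reasoning

    record Factor (L : List Chain) (c : V (total L)) : Set where
      constructor factor
      field
        {j}       : ℕ
        {ℓ′}      : ℕ
        {L′}      : List Chain
        {v′}      : V n
        pick      : Pick (v′ , ℓ′) L L′
        j<ℓ′      : j < ℓ′
        lead      : Carrier
        lead≢0    : ¬ lead ≡ 0#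
        r         : V n
        r-gen     : Gen L′ r
        factors   : eval L c ≡ pow f j (lead ∙ᵥ v′ +ᵥ r)

    -- The chain with the smallest lowest power `j` is singled out, so that `pow f j` factors out of
    -- the whole sum. The rest `r` is generated without that chain: its parts lie in the image of
    -- `f` or come from the other tops.
    eval-factor : ∀ L c → c ≡ 0ᵥ ⊎ Factor L c
    eval-factor []            [] = inj₁ refl
    eval-factor ((v , ℓ) ∷ L) c with chain-factor v (Vec.take ℓ c) | eval-factor L (Vec.drop ℓ c)
    ... | inj₁ p | inj₁ q = inj₁ (take-drop-zero ℓ c p q)
    ... | inj₁ p | inj₂ (factor pk j<ℓ d d≢0 r rg e) =
      inj₂ (factor (there pk) j<ℓ d d≢0 r (gen-mono (top ∘ there) rg)
        (trans (cong (_+ᵥ eval L (Vec.drop ℓ c)) (trans (cong (chain v) p) (zero-map (chain-linear {ℓ} v))))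
               (trans (+ᵥ-identityˡ _) e)))
    ... | inj₂ (j , d , u , j<ℓ , d≢0 , e) | inj₁ q =
      inj₂ (factor here j<ℓ d d≢0 (f u) (img u)
        (trans (cong (chain v (Vec.take ℓ c) +ᵥ_) (trans (cong (eval L) q) (zero-map (eval-linear L))))
               (trans (+ᵥ-identityʳ _) e)))
    ... | inj₂ (j , d , u , j<ℓ , d≢0 , e) | inj₂ (factor {j₂} {v′ = v₂} pk j₂<ℓ₂ d₂ d₂≢0 r rg e₂) with ℕP.<-≤-connex j₂ j
    -- A tie goes to the head chain. Then `o` is 0 and `w` need not lie in the image of `f`, but the
    -- top `v₂` is still among the remaining chains.
    ...   | inj₂ j≤j₂ with o , refl ← ℕP.m≤n⇒∃[o]m+o≡n j≤j₂ =
      inj₂ (factor here j<ℓ d d≢0 (f u +ᵥ pow f o w)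
        (img u ⊹ gen-pow o ((d₂ ⊛ top (pick-∈ pk)) ⊹ gen-mono (top ∘ pick-⊆ pk) rg))
        (begin
          chain v (Vec.take ℓ c) +ᵥ eval L (Vec.drop ℓ c)          ≡⟨ cong₂ _+ᵥ_ e (trans e₂ (pow-+ f j o w)) ⟩
          pow f j (d ∙ᵥ v +ᵥ f u) +ᵥ pow f j (pow f o w)           ≡⟨ pow-linear lf j .add _ _ ⟨
          pow f j ((d ∙ᵥ v +ᵥ f u) +ᵥ pow f o w)                   ≡⟨ cong (pow f j) (+ᵥ-assoc _ _ _) ⟩
          pow f j (d ∙ᵥ v +ᵥ (f u +ᵥ pow f o w))                   ∎))
      where
      open ≡-Reasoning
      w = d₂ ∙ᵥ v₂ +ᵥ r
    ...   | inj₁ j₂<j with o , refl ← ℕP.m≤n⇒∃[o]m+o≡n j₂<j =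
      inj₂ (factor (there pk) j₂<ℓ₂ d₂ d₂≢0 (r +ᵥ pow f (suc o) w)
        (gen-mono (top ∘ there) rg ⊹ subst (Gen _) (sym (pow-comm f o w)) (img _))
        (begin
          chain v (Vec.take ℓ c) +ᵥ eval L (Vec.drop ℓ c)              ≡⟨ cong₂ _+ᵥ_ (trans e (cong (λ i → pow f i w) (sym (ℕP.+-suc j₂ o)))) e₂ ⟩
          pow f (j₂ ℕ.+ suc o) w +ᵥ pow f j₂ (d₂ ∙ᵥ v₂ +ᵥ r)           ≡⟨ cong (_+ᵥ pow f j₂ (d₂ ∙ᵥ v₂ +ᵥ r)) (pow-+ f j₂ (suc o) w) ⟩
          pow f j₂ (pow f (suc o) w) +ᵥ pow f j₂ (d₂ ∙ᵥ v₂ +ᵥ r)       ≡⟨ trans (+ᵥ-comm _ _) (sym (pow-linear lf j₂ .add _ _)) ⟩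
          pow f j₂ ((d₂ ∙ᵥ v₂ +ᵥ r) +ᵥ pow f (suc o) w)                ≡⟨ cong (pow f j₂) (+ᵥ-assoc _ _ _) ⟩
          pow f j₂ (d₂ ∙ᵥ v₂ +ᵥ (r +ᵥ pow f (suc o) w))                ∎))
      where
      open ≡-Reasoning
      w = d ∙ᵥ v +ᵥ f u

    total-pick : ∀ {v ℓ L L′} → Pick (v , ℓ) L L′ → total L ≡ ℓ ℕ.+ total L′
    total-pick here = refl
    total-pick {ℓ = ℓ} (there {y = _ , k} {ys = ys} p) = trans (cong (k ℕ.+_) (total-pick p)) (ℕ-swap k ℓ (total ys))

    solve-top : ∀ {d t} → t * d ≡ 1# → (v r : V n) → v ≡ t ∙ᵥ ((d ∙ᵥ v +ᵥ r) +ᵥ - 1# ∙ᵥ r)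
    solve-top {d} {t} td v r = sym (begin
      t ∙ᵥ ((d ∙ᵥ v +ᵥ r) +ᵥ - 1# ∙ᵥ r)      ≡⟨ cong (t ∙ᵥ_) (+ᵥ-assoc _ _ _) ⟩
      t ∙ᵥ (d ∙ᵥ v +ᵥ (r +ᵥ - 1# ∙ᵥ r))      ≡⟨ cong (λ q → t ∙ᵥ (d ∙ᵥ v +ᵥ (q +ᵥ - 1# ∙ᵥ r))) (1∙ r) ⟨
      t ∙ᵥ (d ∙ᵥ v +ᵥ (1# ∙ᵥ r +ᵥ - 1# ∙ᵥ r)) ≡⟨ cong (λ q → t ∙ᵥ (d ∙ᵥ v +ᵥ q)) (trans (+ᵥ-comm _ _) (neg-cancel 1# r)) ⟩
      t ∙ᵥ (d ∙ᵥ v +ᵥ 0ᵥ)                    ≡⟨ cong (t ∙ᵥ_) (+ᵥ-identityʳ _) ⟩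
      t ∙ᵥ (d ∙ᵥ v)                          ≡⟨ ∙-cancel td v ⟩
      v                                      ∎)
      where open ≡-Reasoning

    record Good (L : List Chain) : Set where
      constructor good
      field
        killed     : Killed L
        generating : Generating L

    -- A relation among the chains has the form f^j w = 0 with w congruent modulo the other chains and the
    -- image of f to a multiple of some top v of a chain of length > j; so (w , j) may replace that chain.
    shorten : ∀ L → Good L → n < total L → ∃ λ L₁ → Good L₁ × total L₁ < total L
    shorten L (good κ gen) n<t
      with c , ec , c≢0 ← nontrivial-kernel (eval L) (eval-linear L) n<t
      with eval-factor L c
    ... | inj₁ c≡0 = ⊥-elim (c≢0 c≡0)
    ... | inj₂ (factor {j} {ℓ′} {L′} {v′} pk j<ℓ d d≢0 r rg e) with t , dt ← inverse d d≢0 =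
      (w , j) ∷ L′ , good κ₁ (λ v → gen-mono tops (gen v)) ,
      subst (j ℕ.+ total L′ <_) (sym (total-pick pk)) (ℕP.+-monoˡ-< (total L′) j<ℓ)
      where
      w = d ∙ᵥ v′ +ᵥ r
      κ₁ : Killed ((w , j) ∷ L′)
      κ₁ (here refl) = trans (sym e) ec
      κ₁ (there p)   = κ (pick-⊆ pk p)
      tops : ∀ {v ℓ} → (v , ℓ) ∈ L → Gen ((w , j) ∷ L′) v
      tops p with pick-cases pk p
      ... | inj₂ q    = top (there q)
      ... | inj₁ refl = subst (Gen _) (sym (solve-top (trans (*-comm t d) dt) v′ r))
                              (t ⊛ (top (here refl) ⊹ ((- 1#) ⊛ gen-mono (top ∘ there) rg)))

    -- `k` bounds the excess of the total length over `n`, and each shortening lowers that excess by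
    -- at least one.
    shorten* : ∀ k L → Good L → total L ≤ n ℕ.+ k → ∃ λ L₁ → Good L₁ × total L₁ ≤ n
    shorten* k L g t≤ with total L ℕP.≤? n
    ... | yes t≤n = L , g , t≤n
    shorten* zero    L g t≤ | no t≰n = ⊥-elim (t≰n (subst (total L ≤_) (ℕP.+-identityʳ n) t≤))
    shorten* (suc k) L g t≤ | no t≰n with L₁ , g₁ , lt ← shorten L g (ℕP.≰⇒> t≰n) =
      shorten* k L₁ g₁ (ℕP.≤-pred (ℕP.≤-trans lt (subst (total L ≤_) (ℕP.+-suc n k) t≤)))

    chainOrder : DecTotalOrder 0ℓ 0ℓ 0ℓ
    chainOrder = On.decTotalOrder (≥-decTotalOrder ℕP.≤-decTotalOrder) (proj₂ {A = V n} {B = λ _ → ℕ})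

    open SortingAlgorithm (mergeSort chainOrder) using () renaming (sort to sortChains; sort-↭ to sortChains-↭; sort-↗ to sortChains-↗)

    positive? : (c : Chain) → Dec (0 < proj₂ c)
    positive? c = 0 ℕP.<? proj₂ c

    normalise : List Chain → List Chain
    normalise L = sortChains (List.filter positive? L)

    normalise-positive : ∀ L → All (0 <_) (lengths (normalise L))
    normalise-positive L = AllP.map⁺ (↭P.All-resp-↭ (↭-sym (sortChains-↭ (List.filter positive? L))) (AllP.all-filter positive? L))

    normalise-sorted : ∀ L → Linked (λ x y → y ≤ x) (lengths (normalise L))
    normalise-sorted L = LinkedP.map⁺ (sortChains-↗ (List.filter positive? L))

    normalise-total : ∀ L → total (normalise L) ≡ total L
    normalise-total L = trans (sum-↭ (↭P.map⁺ proj₂ (sortChains-↭ (List.filter positive? L)))) (filter-total L)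
      where
      filter-total : ∀ L → total (List.filter positive? L) ≡ total L
      filter-total [] = refl
      filter-total ((v , zero)  ∷ L) = filter-total L
      filter-total ((v , suc ℓ) ∷ L) = cong (suc ℓ ℕ.+_) (filter-total L)

    normalise-good : ∀ L → Good L → Good (normalise L)
    normalise-good L (good κ gen) = good
      (λ p → κ (proj₁ (∈P.∈-filter⁻ positive? (↭P.∈-resp-↭ (sortChains-↭ (List.filter positive? L)) p))))
      (λ v → gen-mono tops (gen v))
      where
      tops : ∀ {v ℓ} → (v , ℓ) ∈ L → Gen (normalise L) v
      tops {v} {zero}  p = subst (Gen _) (sym (κ p)) gen-zero
      tops {v} {suc ℓ} p = top (↭P.∈-resp-↭ (↭-sym (sortChains-↭ (List.filter positive? L))) (∈P.∈-filter⁺ positive? p (s≤s z≤n)))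

    -- Finiteness of the field supplies generators at no cost: every vector is a top, and f^N = 0
    -- kills each of them at length `N`.
    allChains : ℕ → List Chain
    allChains N = List.map (_, N) (allVecs elements n)

    allChains-good : ∀ N → (∀ x → pow f N x ≡ 0ᵥ) → Good (allChains N)
    allChains-good N nil = good killed λ v → top (∈P.∈-map⁺ (_, N) (allVecs-complete elements complete v))
      where
      killed : Killed (allChains N)
      killed p with v , _ , refl ← ∈P.∈-map⁻ (_, N) p = nil v

    -- The total length is at most `n` by shortening and at least `n` because `eval L` is onto, so
    -- that its linear section is injective.
    jordan-basis : ∀ N → (∀ x → pow f N x ≡ 0ᵥ) → JordanBasis n f
    jordan-basis N nil
      with L₁ , g₁ , t₁≤n ← shorten* (total (allChains N)) (allChains N) (allChains-good N nil) (ℕP.m≤n+m _ n)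
      = lengths L , (normalise-positive L₁ , normalise-sorted L₁ , ℕP.≤-antisym t≤n n≤t)
      , eval L , s , eval-linear L , ls , es , eval-Jop L killed
      where
      L = normalise L₁
      open Good (normalise-good L₁ g₁)
      onto : ∀ v → ∃ λ x → eval L x ≡ v
      onto v with x , u , e ← eval-onto-mod L killed generating N v =
        x , sym (trans e (trans (cong (eval L x +ᵥ_) (nil u)) (+ᵥ-identityʳ _)))
      sec = section (eval L) id (eval-linear L) lin-id onto
      s  = proj₁ sec
      ls = proj₁ (proj₂ sec)
      es = proj₂ (proj₂ sec)
      n≤t : n ≤ total L
      n≤t = injective⇒≤ s ls (leftInverse⇒injective (eval-linear L) es)
      t≤n : total L ≤ n
      t≤n = subst (_≤ n) (sym (normalise-total L₁)) t₁≤n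

  jordanBasis⇒inClass : (X : Matrix n n) → JordanBasis n (X *ᵥ_) → ∃ λ ν → IsPartition ν n × InClass 𝔽 ν X
  jordanBasis⇒inClass X (ν , part@(_ , _ , refl) , e , s , le , ls , es , ej) = ν , part , opConj⇒inClass ν X (OpConj-sym
    (record { to = e ; from = s ; to-linear = le ; from-linear = ls ; to-from = es ; intertwine = ej }))

  nilpotent⇒inClass : (X : Matrix n n) → ∀ N → (∀ x → pow (X *ᵥ_) N x ≡ 0ᵥ) → ∃ λ ν → IsPartition ν n × InClass 𝔽 ν X
  nilpotent⇒inClass X N nil = jordanBasis⇒inClass X (Chains.jordan-basis (X *ᵥ_) (*ᵥ-linear X) N nil)

  -- Nilradicals

  -- `InNilradical` with the size freed from `sumL Λ`: for `Λ ∷ʳ m` the block form needs the size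
  -- `sumL Λ + m`, which equals the sum only propositionally.
  InNil : List ℕ → Matrix n n → Set
  InNil Λ X = ∀ i j → blockOf Λ (toℕ j) ≤ blockOf Λ (toℕ i) → entry 𝔽 X i j ≡ 0#

  InNil? : ∀ Λ (X : Matrix n n) → Dec (InNil Λ X)
  InNil? Λ X = FinP.all? λ i → FinP.all? λ j → (blockOf Λ (toℕ j) ℕP.≤? blockOf Λ (toℕ i)) →-dec (entry 𝔽 X i j ≟ 0#)

  -- A row of X only meets coordinates in later blocks. Hence the coordinates of X^k x in block b
  -- vanish as soon as b + k reaches the number of blocks.
  nilradical-nilpotent : ∀ Λ (X : Matrix n n) → InNil Λ X → (∀ i → blockOf Λ (toℕ {n} i) < length Λ) →
    ∀ x → pow (X *ᵥ_) (length Λ) x ≡ 0ᵥ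
  nilradical-nilpotent {n} Λ X nil bound x = lookup-ext _ _ λ i →
    trans (vanish (length Λ) i (ℕP.m≤n+m (length Λ) _)) (sym (VecP.lookup-replicate i 0#))
    where
    vanish : ∀ k i → length Λ ≤ blockOf Λ (toℕ {n} i) ℕ.+ k → lookup (pow (X *ᵥ_) k x) i ≡ 0#
    vanish zero    i le = ⊥-elim (ℕP.<⇒≱ (bound i) (subst (length Λ ≤_) (ℕP.+-identityʳ _) le))
    vanish (suc k) i le = trans (cong (λ v → lookup v i) (pow-comm (X *ᵥ_) k x))
      (trans (lookup-*ᵥ X _ i) (sum-zero _ λ j → term j (blockOf Λ (toℕ j) ℕP.≤? blockOf Λ (toℕ i))))
      where
      term : ∀ j → Dec (blockOf Λ (toℕ j) ≤ blockOf Λ (toℕ i)) → entry 𝔽 X i j * lookup (pow (X *ᵥ_) k x) j ≡ 0#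
      term j (yes p) = trans (cong (_* _) (nil i j p)) (zeroˡ _)
      term j (no ¬p) = trans (cong (entry 𝔽 X i j *_) (vanish k j
        (ℕP.≤-trans le (subst (_≤ blockOf Λ (toℕ j) ℕ.+ k) (sym (ℕP.+-suc (blockOf Λ (toℕ i)) k)) (ℕP.+-monoˡ-≤ k (ℕP.≰⇒> ¬p)))))) (zeroʳ _)

  -- Splitting off the last block

  entry-ext : (X Y : Matrix a b) → (∀ i j → entry 𝔽 X i j ≡ entry 𝔽 Y i j) → X ≡ Y
  entry-ext []      []      e = refl
  entry-ext (r ∷ X) (s ∷ Y) e = cong₂ _∷_ (lookup-ext r s (e Fin.zero)) (entry-ext X Y (e ∘ Fin.suc))

  topLeft : ∀ a → Matrix (a ℕ.+ m) (a ℕ.+ m) → Matrix a a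
  topLeft {m} a X = tabulate λ i → tabulate λ j → entry 𝔽 X (i ↑ˡ m) (j ↑ˡ m)

  topRight : ∀ a → Matrix (a ℕ.+ m) (a ℕ.+ m) → Matrix a m
  topRight {m} a X = tabulate λ i → tabulate λ j → entry 𝔽 X (i ↑ˡ m) (a ↑ʳ j)

  entry-blk : (A : Matrix a a) (Z : Matrix a m) → ∀ i j → entry 𝔽 (blk A Z) i j ≡ blk-entry A Z (splitAt a i) (splitAt a j)
  entry-blk {a} A Z = entry-tabulate λ i j → blk-entry A Z (splitAt a i) (splitAt a j)

  topLeft-blk : (A : Matrix a a) (Z : Matrix a m) → topLeft a (blk A Z) ≡ A
  topLeft-blk {a} {m} A Z = entry-ext _ _ λ i j → trans (entry-tabulate _ i j) (trans (entry-blk A Z _ _)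
    (cong₂ (blk-entry A Z) (FinP.splitAt-↑ˡ a i m) (FinP.splitAt-↑ˡ a j m)))

  topRight-blk : (A : Matrix a a) (Z : Matrix a m) → topRight a (blk A Z) ≡ Z
  topRight-blk {a} {m} A Z = entry-ext _ _ λ i j → trans (entry-tabulate _ i j) (trans (entry-blk A Z _ _)
    (cong₂ (blk-entry A Z) (FinP.splitAt-↑ˡ a i m) (FinP.splitAt-↑ʳ a m j)))

  inNil-topLeft : ∀ Λ m (X : Matrix (sumL Λ ℕ.+ m) (sumL Λ ℕ.+ m)) → InNil (Λ List.∷ʳ m) X → InNil Λ (topLeft (sumL Λ) X)
  inNil-topLeft Λ m X nil i j le = trans (entry-tabulate _ i j) (nil _ _ (subst₂ _≤_ (sym (block j)) (sym (block i)) le))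
    where
    block : ∀ (i : Fin (sumL Λ)) → blockOf (Λ List.∷ʳ m) (toℕ (i ↑ˡ m)) ≡ blockOf Λ (toℕ i)
    block i = trans (cong (blockOf (Λ List.∷ʳ m)) (FinP.toℕ-↑ˡ i m)) (proj₁ (blockOf-++ˡ Λ m (FinP.toℕ<n i)))

  blockOf-splitAt : ∀ Λ m (i : Fin (sumL Λ ℕ.+ m)) →
    blockOf (Λ List.∷ʳ m) (toℕ i) ≡ [ (λ i → blockOf Λ (toℕ i)) , (λ _ → length Λ) ]′ (splitAt (sumL Λ) i)
  blockOf-splitAt Λ m i with splitAt (sumL Λ) i in eq
  ... | inj₁ i′ rewrite sym (FinP.splitAt⁻¹-↑ˡ eq) =
    trans (cong (blockOf (Λ List.∷ʳ m)) (FinP.toℕ-↑ˡ i′ m)) (proj₁ (blockOf-++ˡ Λ m (FinP.toℕ<n i′)))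
  ... | inj₂ i′ rewrite sym (FinP.splitAt⁻¹-↑ʳ {m = sumL Λ} eq) =
    trans (cong (blockOf (Λ List.∷ʳ m)) (FinP.toℕ-↑ʳ (sumL Λ) i′)) (blockOf-++ʳ Λ (toℕ i′) (FinP.toℕ<n i′))

  inNil⇒blk : ∀ Λ m (X : Matrix (sumL Λ ℕ.+ m) (sumL Λ ℕ.+ m)) → InNil (Λ List.∷ʳ m) X → X ≡ blk (topLeft (sumL Λ) X) (topRight (sumL Λ) X)
  inNil⇒blk Λ m X nil = entry-ext _ _ λ i j → trans (cases i j (splitAt (sumL Λ) i) (splitAt (sumL Λ) j) refl refl) (sym (entry-blk (topLeft (sumL Λ) X) (topRight (sumL Λ) X) i j))
    where
    cases : ∀ i j s t → splitAt (sumL Λ) i ≡ s → splitAt (sumL Λ) j ≡ t →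
            entry 𝔽 X i j ≡ blk-entry (topLeft (sumL Λ) X) (topRight (sumL Λ) X) (splitAt (sumL Λ) i) (splitAt (sumL Λ) j)
    cases i j (inj₁ i′) (inj₁ j′) p q rewrite p | q | sym (FinP.splitAt⁻¹-↑ˡ p) | sym (FinP.splitAt⁻¹-↑ˡ q) =
      sym (entry-tabulate _ i′ j′)
    cases i j (inj₁ i′) (inj₂ j′) p q rewrite p | q | sym (FinP.splitAt⁻¹-↑ˡ p) | sym (FinP.splitAt⁻¹-↑ʳ {m = sumL Λ} q) =
      sym (entry-tabulate _ i′ j′)
    -- Row `i` lies in the last block, whose index no other exceeds, so the whole row is 0.
    cases i j (inj₂ i′) t         p q rewrite p = nil i j (subst₂ _≤_ (sym (blockOf-splitAt Λ m j))
      (sym (trans (blockOf-splitAt Λ m i) (cong [ _ , _ ]′ p))) (last (splitAt (sumL Λ) j)))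
      where
      last : ∀ t → [ (λ i → blockOf Λ (toℕ i)) , (λ _ → length Λ) ]′ t ≤ length Λ
      last (inj₁ j) = ℕP.<⇒≤ (proj₂ (blockOf-++ˡ Λ m (FinP.toℕ<n j)))
      last (inj₂ _) = ℕP.≤-refl

  blk-inNil : ∀ Λ (A : Matrix (sumL Λ) (sumL Λ)) (Z : Matrix (sumL Λ) m) → InNil Λ A → InNil (Λ List.∷ʳ m) (blk A Z)
  blk-inNil {m} Λ A Z nil i j le = trans (entry-blk A Z i j)
    (cases (splitAt (sumL Λ) i) (splitAt (sumL Λ) j) (subst₂ _≤_ (blockOf-splitAt Λ m j) (blockOf-splitAt Λ m i) le))
    where
    block : Fin (sumL Λ) ⊎ Fin m → ℕ
    block = [ (λ i → blockOf Λ (toℕ i)) , (λ _ → length Λ) ]′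
    cases : ∀ s t → block t ≤ block s → blk-entry A Z s t ≡ 0#
    cases (inj₁ i) (inj₁ j) le = nil i j le
    cases (inj₁ i) (inj₂ j) le = ⊥-elim (ℕP.<⇒≱ (proj₂ (blockOf-++ˡ Λ m (FinP.toℕ<n i))) le)
    cases (inj₂ i) t        le = refl

  -- Kernels of powers in the nilradical, and dominance

  blk-pow : (A : Matrix a a) (Z : Matrix a m) → ∀ k x → pow (blk A Z *ᵥ_) k (x Vec.++ 0ᵥ) ≡ pow (A *ᵥ_) k x Vec.++ 0ᵥ
  blk-pow A Z zero    x = refl
  blk-pow A Z (suc k) x = trans (cong (pow (blk A Z *ᵥ_) k) (trans (blk-*ᵥ A Z x 0ᵥ)
    (cong (Vec._++ 0ᵥ) (trans (cong (A *ᵥ x +ᵥ_) (zero-map (*ᵥ-linear Z))) (+ᵥ-identityʳ _))))) (blk-pow A Z k (A *ᵥ x))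

  kernelDim-mono : ∀ {j k} {f : V n → V n} → Linear f → j ≤ k → KernelDim f j d → KernelDim f k d
  kernelDim-mono {j = j} {k} {f} lf j≤k D = record
    { embed = D .embed ; embed-linear = D .embed-linear ; embed-injective = D .embed-injective
    ; embed-kernel = λ x → begin
        pow f k (D .embed x)                      ≡⟨ cong (λ i → pow f i (D .embed x)) (ℕP.m∸n+n≡m j≤k) ⟨
        pow f (k ℕ.∸ j ℕ.+ j) (D .embed x)        ≡⟨ pow-+ f (k ℕ.∸ j) j _ ⟩
        pow f (k ℕ.∸ j) (pow f j (D .embed x))    ≡⟨ cong (pow f (k ℕ.∸ j)) (D .embed-kernel x) ⟩
        pow f (k ℕ.∸ j) 0ᵥ                        ≡⟨ pow-zero lf (k ℕ.∸ j) ⟩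
        0ᵥ                                        ∎ }
    where open ≡-Reasoning

  kernelDim-blk : (A : Matrix a a) (Z : Matrix a m) → KernelDim (A *ᵥ_) k d → KernelDim (blk A Z *ᵥ_) k d
  kernelDim-blk {a} {k = k} A Z D = record
    { embed = λ x → D .embed x Vec.++ 0ᵥ
    ; embed-linear = lin-++ (D .embed-linear) lin-0
    ; embed-injective = λ x e → D .embed-injective x (++-zero⁻ˡ (D .embed x) 0ᵥ e)
    ; embed-kernel = λ x → trans (blk-pow A Z k (D .embed x)) (trans (cong (Vec._++ 0ᵥ) (D .embed-kernel x)) (++-zero a)) }

  -- The preimage of a d-dimensional subspace E under (A Z) has dimension at least d + m: it contains the
  -- projection of the kernel of (x , u , y) ↦ A x + Z y + E u.
  kernelDim-blk-suc : (A : Matrix a a) (Z : Matrix a m) → KernelDim (A *ᵥ_) k d → KernelDim (blk A Z *ᵥ_) (suc k) (d ℕ.+ m)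
  kernelDim-blk-suc {a} {m} {k} {d} A Z D = record
    { embed           = λ t → x-part t Vec.++ y-part t
    ; embed-linear    = lin-++ (lin-∘ (lin-take a) ι-linear) (lin-∘ lin-y ι-linear)
    ; embed-injective = injective
    ; embed-kernel    = λ t → begin
        pow (blk A Z *ᵥ_) k (blk A Z *ᵥ (x-part t Vec.++ y-part t))
          ≡⟨ cong (pow (blk A Z *ᵥ_) k) (trans (blk-*ᵥ A Z (x-part t) (y-part t)) (cong (Vec._++ 0ᵥ) (neg-unique _ _ (ι-kernel t)))) ⟩
        pow (blk A Z *ᵥ_) k ((- 1# ∙ᵥ E (u-part t)) Vec.++ 0ᵥ)
          ≡⟨ blk-pow A Z k _ ⟩
        pow (A *ᵥ_) k (- 1# ∙ᵥ E (u-part t)) Vec.++ 0ᵥ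
          ≡⟨ cong (Vec._++ 0ᵥ) (trans (pow-linear (*ᵥ-linear A) k .scale (- 1#) _)
               (trans (cong (- 1# ∙ᵥ_) (D .embed-kernel (u-part t))) (∙0 (- 1#)))) ⟩
        0ᵥ {a} Vec.++ 0ᵥ
          ≡⟨ ++-zero a ⟩
        0ᵥ ∎ }
    where
    open ≡-Reasoning
    E = D .embed
    lin-u : Linear (λ w → Vec.take d (Vec.drop a w))
    lin-u = lin-∘ (lin-take d) (lin-drop a)
    lin-y : Linear (λ w → Vec.drop d {m} (Vec.drop a w))
    lin-y = lin-∘ (lin-drop d) (lin-drop a)
    Φ : V (a ℕ.+ (d ℕ.+ m)) → V a
    Φ w = (A *ᵥ Vec.take a w +ᵥ Z *ᵥ Vec.drop d (Vec.drop a w)) +ᵥ E (Vec.take d (Vec.drop a w))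
    ker = kernel a Φ (lin-+ (lin-+ (lin-∘ (*ᵥ-linear A) (lin-take a)) (lin-∘ (*ᵥ-linear Z) lin-y)) (lin-∘ (D .embed-linear) lin-u))
    ι           = proj₁ ker
    ι-linear    = proj₁ (proj₂ ker)
    ι-injective = proj₁ (proj₂ (proj₂ ker))
    ι-kernel    = proj₂ (proj₂ (proj₂ ker))
    x-part : V (d ℕ.+ m) → V a
    x-part t = Vec.take a (ι t)
    u-part : V (d ℕ.+ m) → V d
    u-part t = Vec.take d (Vec.drop a (ι t))
    y-part : V (d ℕ.+ m) → V m
    y-part t = Vec.drop d (Vec.drop a (ι t))
    injective : Injective₀ (λ t → x-part t Vec.++ y-part t)
    injective t e = ι-injective t (take-drop-zero a (ι t) x≡0 (take-drop-zero d (Vec.drop a (ι t)) u≡0 y≡0))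
      where
      x≡0 = ++-zero⁻ˡ (x-part t) (y-part t) e
      y≡0 = ++-zero⁻ʳ (x-part t) (y-part t) e
      -- With x and y zero the kernel equation reduces to E u = 0, so forgetting u loses no
      -- dimension.
      u≡0 : u-part t ≡ 0ᵥ
      u≡0 = D .embed-injective (u-part t) (begin
        E (u-part t)                                              ≡⟨ +ᵥ-identityˡ _ ⟨
        0ᵥ +ᵥ E (u-part t)                                        ≡⟨ cong (_+ᵥ E (u-part t)) (+ᵥ-identityˡ 0ᵥ) ⟨
        (0ᵥ +ᵥ 0ᵥ) +ᵥ E (u-part t)                                ≡⟨ cong₂ (λ p q → (p +ᵥ q) +ᵥ E (u-part t))
                                                                       (trans (cong (A *ᵥ_) x≡0) (zero-map (*ᵥ-linear A)))
                                                                       (trans (cong (Z *ᵥ_) y≡0) (zero-map (*ᵥ-linear Z))) ⟨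
        (A *ᵥ x-part t +ᵥ Z *ᵥ y-part t) +ᵥ E (u-part t)          ≡⟨ ι-kernel t ⟩
        0ᵥ                                                        ∎)

  -- All sublists are treated, not only prefixes, because dominance for the sorted composition needs
  -- the largest blocks wherever they stand. A last block outside `S` changes neither number; one
  -- inside raises the exponent by one and the dimension by `m`.
  nilradical-kernelDim : ∀ {Λ} → Reverse Λ → (X : Matrix n n) → sumL Λ ≡ n → InNil Λ X →
    ∀ {S} → S ⊆ Λ → KernelDim (X *ᵥ_) (length S) (sumL S)
  nilradical-kernelDim [] X refl nil [] = record
    { embed = id ; embed-linear = lin-id ; embed-injective = λ _ e → e ; embed-kernel = λ { [] → refl } }
  nilradical-kernelDim {n} (Λ ∶ rs ∶ʳ m) X e nil {S} S⊆Λm with refl ← trans (sym e) (sum-∷ʳ Λ m) =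
    subst (λ X → KernelDim (X *ᵥ_) (length S) (sumL S)) (sym (inNil⇒blk Λ m X nil)) (step (sublist-∷ʳ Λ S⊆Λm))
    where
    A = topLeft (sumL Λ) X
    IH : ∀ {S} → S ⊆ Λ → KernelDim (A *ᵥ_) (length S) (sumL S)
    IH = nilradical-kernelDim rs A refl (inNil-topLeft Λ m X nil)
    step : ∀ {S} → S ⊆ Λ ⊎ (∃ λ S′ → S ≡ S′ List.∷ʳ m × S′ ⊆ Λ) → KernelDim (blk A (topRight (sumL Λ) X) *ᵥ_) (length S) (sumL S)
    step (inj₁ s)               = kernelDim-blk A (topRight (sumL Λ) X) (IH s)
    step (inj₂ (S′ , refl , s)) = subst₂ (KernelDim (blk A (topRight (sumL Λ) X) *ᵥ_))
      (sym (trans (ListP.length-++ S′) (ℕP.+-comm (length S′) 1))) (sym (sum-∷ʳ S′ m)) (kernelDim-blk-suc A (topRight (sumL Λ) X) (IH s))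

  -- The kernel built from the `k` largest blocks is measured against the bound `capSum k ν` for the
  -- Jordan type. Enlarging the exponent to `k` covers selections of fewer than `k` parts.
  nilradical-dominance : ∀ Λ ν (X : Matrix n n) → sumL Λ ≡ n → InNil Λ X → InClass 𝔽 ν X → sortDesc Λ ⊴ conj ν
  nilradical-dominance Λ ν X e nil c k with S , S⊆Λ , len , sum≡ ← topParts k Λ =
    subst₂ _≤_ sum≡ (sym (take-conj k ν))
      (inClass⇒kernelDim-≤ ν X c (kernelDim-mono (*ᵥ-linear X) len (nilradical-kernelDim (reverseView Λ) X e nil S⊆Λ)))

  -- Counting

  matrices-unique : ∀ a b → Unique (allMats 𝔽 a b)
  matrices-unique a b = allVecs-unique (allVecs-unique unique b) a

  module _ {A B : Matrix a a} (p : OpConj (A *ᵥ_) (B *ᵥ_)) where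

    transport : Matrix a m → Matrix a m
    transport Z = toMatrix (λ y → p .to (Z *ᵥ y))

    transport-*ᵥ : (Z : Matrix a m) → ∀ y → transport Z *ᵥ y ≡ p .to (Z *ᵥ y)
    transport-*ᵥ Z = toMatrix-*ᵥ _ (lin-∘ (p .to-linear) (*ᵥ-linear Z))

    transport-injective : {Z W : Matrix a m} → transport Z ≡ transport W → Z ≡ W
    transport-injective {Z = Z} {W} e = matrix-ext Z W λ y → begin
      Z *ᵥ y                     ≡⟨ from-to p (Z *ᵥ y) ⟨
      p .from (p .to (Z *ᵥ y))   ≡⟨ cong (p .from) (trans (sym (transport-*ᵥ Z y)) (trans (cong (_*ᵥ y) e) (transport-*ᵥ W y))) ⟩
      p .from (p .to (W *ᵥ y))   ≡⟨ from-to p (W *ᵥ y) ⟩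
      W *ᵥ y                     ∎
      where open ≡-Reasoning

    transport-inClass : ∀ μ (Z : Matrix a m) → InClass 𝔽 μ (blk A Z) → InClass 𝔽 μ (blk B (transport Z))
    transport-inClass {m} μ Z (e , c) = e , Conj-trans {X = blk B (transport Z)} {blk A Z} {jordan 𝔽 μ (a ℕ.+ m)}
      (Conj-sym {X = blk A Z} {blk B (transport Z)} (blk-conj {A = A} {B} Z (transport Z) p (transport-*ᵥ Z))) c

    count-blk-≤ : ∀ μ m →
      count (λ Z → InClass? 𝔽 μ (blk A Z)) (allMats 𝔽 a m) ≤ count (λ Z → InClass? 𝔽 μ (blk B Z)) (allMats 𝔽 a m)
    count-blk-≤ μ m = count-≤ _ _ (matrices-unique a m) (allMats-complete 𝔽) transport
      (λ _ _ → transport-injective) (λ {Z} → transport-inClass μ Z)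

  -- The map Z to g Z has an inverse of the same kind, so the inequality applied to `p` and to its
  -- inverse gives equality.
  count-blk≡Gstar : ∀ μ ν m (A : Matrix a a) → InClass 𝔽 ν A →
    count (λ Z → InClass? 𝔽 μ (blk A Z)) (allMats 𝔽 a m) ≡ Gstar 𝔽 μ ν m
  count-blk≡Gstar μ ν m A (refl , c) = trans
    (ℕP.≤-antisym (count-blk-≤ {A = A} {J 𝔽 ν} p μ m) (count-blk-≤ {A = J 𝔽 ν} {A} (OpConj-sym p) μ m))
    (count-cong _ _ (λ {Z} → subst (InClass 𝔽 μ) (sym (blockMat≡blk ν m Z))) (λ {Z} → subst (InClass 𝔽 μ) (blockMat≡blk ν m Z))
      (allMats 𝔽 (sumL ν) m))
    where
    p : OpConj (A *ᵥ_) (J 𝔽 ν *ᵥ_)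
    p = Conj⇒OpConj {X = A} {J 𝔽 ν} c

  eligible : ∀ μ ν m (A : Matrix a a) (Z : Matrix a m) → InClass 𝔽 ν A → InClass 𝔽 μ (blk A Z) → Eligible 𝔽 μ ν m
  eligible μ ν m A Z (refl , c) c′ = transport {A = A} {J 𝔽 ν} p Z ,
    subst (InClass 𝔽 μ) (sym (blockMat≡blk ν m (transport {A = A} {J 𝔽 ν} p Z))) (transport-inClass {A = A} {J 𝔽 ν} p μ Z c′)
    where
    p : OpConj (A *ᵥ_) (J 𝔽 ν *ᵥ_)
    p = Conj⇒OpConj {X = A} {J 𝔽 ν} c

  -- With the size as a variable the equation can be eliminated, and `F` can be read on matrices of
  -- size `sumL Λ + m`.
  F≡count : ∀ μ Λ → sumL Λ ≡ n → F 𝔽 μ Λ ≡ count (λ X → InNil? Λ X ×-dec InClass? 𝔽 μ X) (allMats 𝔽 n n)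
  F≡count μ Λ refl = refl

  inBlocks? : ∀ μ Λ m (z : Matrix (sumL Λ) (sumL Λ) × Matrix (sumL Λ) m) →
    Dec (InNil Λ (proj₁ z) × InClass 𝔽 μ (blk (proj₁ z) (proj₂ z)))
  inBlocks? μ Λ m z = InNil? Λ (proj₁ z) ×-dec InClass? 𝔽 μ (blk (proj₁ z) (proj₂ z))

  pairs : ∀ a m → List (Matrix a a × Matrix a m)
  pairs a m = List.cartesianProduct (allMats 𝔽 a a) (allMats 𝔽 a m)

  F≡count-pairs : ∀ μ Λ m → F 𝔽 μ (Λ List.∷ʳ m) ≡ count (inBlocks? μ Λ m) (pairs (sumL Λ) m)
  F≡count-pairs μ Λ m = trans (F≡count μ (Λ List.∷ʳ m) (sum-∷ʳ Λ m)) (ℕP.≤-antisym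
    (count-≤ _ _ (matrices-unique _ _)
      (λ z → ∈P.∈-cartesianProduct⁺ (allMats-complete 𝔽 (proj₁ z)) (allMats-complete 𝔽 (proj₂ z)))
      (λ X → topLeft (sumL Λ) X , topRight (sumL Λ) X)
      (λ {X} {Y} (nilX , _) (nilY , _) e → trans (inNil⇒blk Λ m X nilX)
        (trans (cong₂ blk (cong proj₁ e) (cong proj₂ e)) (sym (inNil⇒blk Λ m Y nilY))))
      (λ {X} (nilX , c) → inNil-topLeft Λ m X nilX , subst (InClass 𝔽 μ) (inNil⇒blk Λ m X nilX) c))
    (count-≤ _ _ (UniqueP.cartesianProduct⁺ (matrices-unique _ _) (matrices-unique _ _)) (allMats-complete 𝔽)
      (λ (A , Z) → blk A Z)
      (λ { {A , Z} {B , W} _ _ e → cong₂ _,_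
        (trans (sym (topLeft-blk A Z)) (trans (cong (topLeft (sumL Λ)) e) (topLeft-blk B W)))
        (trans (sym (topRight-blk A Z)) (trans (cong (topRight (sumL Λ)) e) (topRight-blk B W))) })
      (λ { {A , Z} (nilA , c) → blk-inNil Λ A Z nilA , c })))

  nilradical-type : ∀ Λ (A : Matrix (sumL Λ) (sumL Λ)) → InNil Λ A → ∃ λ ν → IsPartition ν (sumL Λ) × InClass 𝔽 ν A
  nilradical-type Λ A nilA = nilpotent⇒inClass A (length Λ)
    -- The 0 is a dummy last block; the second component is the bound on block indices within `Λ`.
    (nilradical-nilpotent Λ A nilA λ i → proj₂ (blockOf-++ˡ Λ 0 (FinP.toℕ<n i)))

  partition-unique : ∀ {k} ν ν′ (A : Matrix n n) → IsPartition ν k → IsPartition ν′ k → InClass 𝔽 ν A → InClass 𝔽 ν′ A → ν ≡ ν′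
  partition-unique ν ν′ A (pos , desc , _) (pos′ , desc′ , _) c c′ =
    capSum-injective ν ν′ pos pos′ desc desc′ (inClass⇒capSum≡ ν ν′ A c c′)

  branching : ∀ μ Λ m (νs : List (List ℕ)) → Unique νs →
    (∀ ν → (ν ∈ νs) ⇔ (IsPartition ν (sumL Λ) × sortDesc Λ ⊴ conj ν × Eligible 𝔽 μ ν m)) →
    F 𝔽 μ (Λ List.∷ʳ m) ≡ sumL (List.map (λ ν → Gstar 𝔽 μ ν m ℕ.* F 𝔽 ν Λ) νs)
  branching μ Λ m νs νs! spec = begin
    F 𝔽 μ (Λ List.∷ʳ m)
      ≡⟨ F≡count-pairs μ Λ m ⟩
    count (inBlocks? μ Λ m) (pairs (sumL Λ) m)
      ≡⟨ count-partition (inBlocks? μ Λ m) ofType? νs νs! cover (λ { _ ((nilA , _) , c) → nilA , c })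
           (λ { {ν} {ν′} {A , _} ν∈ ν′∈ ((_ , c) , _) ((_ , c′) , _) →
                partition-unique ν ν′ A (proj₁ (Equivalence.to (spec ν) ν∈)) (proj₁ (Equivalence.to (spec ν′) ν′∈)) c c′ })
           (pairs (sumL Λ) m) ⟩
    sumL (List.map (λ ν → count (ofType? ν) (pairs (sumL Λ) m)) νs)
      ≡⟨ cong sumL (ListP.map-cong (λ ν → count-cartesianProduct _ _ _ (Gstar 𝔽 μ ν m)
           (λ { A (_ , c) → count-blk≡Gstar μ ν m A c }) (allMats 𝔽 (sumL Λ) (sumL Λ))) νs) ⟩
    sumL (List.map (λ ν → Gstar 𝔽 μ ν m ℕ.* F 𝔽 ν Λ) νs) ∎
    where
    open ≡-Reasoning
    ofType? : ∀ ν (z : Matrix (sumL Λ) (sumL Λ) × Matrix (sumL Λ) m) →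
      Dec ((InNil Λ (proj₁ z) × InClass 𝔽 ν (proj₁ z)) × InClass 𝔽 μ (blk (proj₁ z) (proj₂ z)))
    ofType? ν z = (InNil? Λ (proj₁ z) ×-dec InClass? 𝔽 ν (proj₁ z)) ×-dec InClass? 𝔽 μ (blk (proj₁ z) (proj₂ z))
    -- The type of `A` passes every condition that defines `νs`: dominance holds throughout the
    -- nilradical, and `Z`, carried along with `A` to J_ν, witnesses eligibility.
    cover : ∀ {z} → InNil Λ (proj₁ z) × InClass 𝔽 μ (blk (proj₁ z) (proj₂ z)) →
      ∃ λ ν → ν ∈ νs × (InNil Λ (proj₁ z) × InClass 𝔽 ν (proj₁ z)) × InClass 𝔽 μ (blk (proj₁ z) (proj₂ z))
    cover {A , Z} (nilA , c) =
      let ν , part , cA = nilradical-type Λ A nilA in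
      ν , Equivalence.from (spec ν) (part , nilradical-dominance Λ ν A refl nilA cA , eligible μ ν m A Z cA c) ,
      (nilA , cA) , c

open import Data.List using (_++_; [_]; map)
open import Data.Nat using (_∸_; _*_)

theorem4p1 : (𝔽 : FiniteField) (n : ℕ) (Λstar : List ℕ) (m : ℕ) →
    IsComposition (Λstar ++ [ m ]) n →
    (μ : List ℕ) → IsPartition μ n → sortDesc (Λstar ++ [ m ]) ⊴ conj μ →
    (νs : List (List ℕ)) → Unique νs →
    (∀ ν → (ν ∈ νs) ⇔ (IsPartition ν (n ∸ m) × sortDesc Λstar ⊴ conj ν × Eligible 𝔽 μ ν m)) →
    F 𝔽 μ (Λstar ++ [ m ]) ≡ sumL (map (λ ν → Gstar 𝔽 μ ν m * F 𝔽 ν Λstar) νs)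
theorem4p1 𝔽 n Λstar m (_ , sum≡n) μ _ _ νs νs! spec = branching 𝔽 μ Λstar m νs νs! λ ν →
  subst (λ k → (ν ∈ νs) ⇔ (IsPartition ν k × sortDesc Λstar ⊴ conj ν × Eligible 𝔽 μ ν m)) n∸m≡ (spec ν)
  where
  n∸m≡ : n ∸ m ≡ sumL Λstar
  n∸m≡ = trans (cong (_∸ m) (trans (sym sum≡n) (sum-∷ʳ Λstar m))) (ℕP.m+n∸n≡m (sumL Λstar) m)
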